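{- Let $\ell\ge3$. Suppose that $\lambda$ is an $(\ell,0)$-JM partition and $0\le i<\ell$. Write $\widehat\varphi=\widehat\varphi_i(\lambda)$ and $\widehat\varepsilon=\widehat\varepsilon_i(\lambda)$. Then 1. $\widehat f_i^{\,\widehat\varphi}\lambda$ is an $(\ell,0)$-JM partition; 2. $\widehat e_i^{\,\widehat\varepsilon}\lambda$ is an $(\ell,0)$-JM partition.
   Context: $h^\lambda_{(a,b)}$ is the hook length of the box in row $a$, column $b$: the number of boxes of $\lambda$ to the right of and below $(a,b)$ (same row or column), including $(a,b)$. A partition $\lambda$ is an $(\ell,0)$-JM partition if there do not exist boxes $(a,b),(a,y),(x,b)$ in its Young diagram with $\ell\mid h^\lambda_{(a,b)}$, $\ell\nmid h^\lambda_{(a,y)}$ and $\ell\nmid h^\lambda_{(x,b)}$. Ladder crystal operators. The position $(a,b)$ (row $a$, column $b$) has residue $b-a\bmod\ell$. The ladder of $(a,b)$ is the set of positions $(c,d)$, $c,d\ge1$, with $c-a=(\ell-1)(b-d)$; all its positions have the same residue, and it is an $i$-ladder if that residue is $i$. Ladders are ordered left to right, i.e. by increasing value of $a+(\ell-1)(b-1)$. A box of $\lambda$ of residue $i$ whose removal leaves a partition is a removable $i$-box; a position of residue $i$ not in $\lambda$ whose addition gives a partition is an addable $i$-box. Given a partition $\lambda$, label each addable $i$-box $+$ and each removable $i$-box $-$; the ladder $i$-signature is the word read from leftmost $i$-ladder to rightmost $i$-ladder, and from top to bottom on each ladder. Repeatedly cancel adjacent pairs $-+$ to get the reduced ladder $i$-signature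 $+\cdots+-\cdots-$. The number of remaining $+$'s is $\widehat\varphi_i(\lambda)$ and the number of remaining $-$'s is $\widehat\varepsilon_i(\lambda)$. $\widehat f_i\lambda$ is $\lambda$ together with the box of the rightmost remaining $+$ (or $0$ if there is none); $\widehat e_i\lambda$ is $\lambda$ with the box of the leftmost remaining $-$ removed (or $0$ if there is none). -}

module Defs where

open import Data.Integer.Base using (_⊖_)
open import Data.Integer.DivMod using (_%ℕ_)
open import Data.List.Base
  using (List; []; _∷_; concatMap; cartesianProduct; filter; foldr; head; last; length; map; mapMaybe; upTo)
open import Data.Maybe.Base as Maybe using (Maybe; just; nothing; _>>=_)
open import Data.Nat.Base
open import Data.Nat.Divisibility using (_∣_; _∤_)
open import Data.Nat.Properties
open import Data.Product.Base using (∃; _×_; _,_; proj₁; proj₂)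
open import Data.Sum.Base using (_⊎_; inj₁; inj₂)
open import Function.Base using (_∘_)
open import Function.Bundles using (_⇔_; mk⇔; module Equivalence)
open import Relation.Binary.PropositionalEquality
  using (_≡_; _≢_; refl; sym; trans; cong; subst)
open import Relation.Nullary.Decidable.Core using (Dec; yes; no; map′; _×-dec_; _⊎-dec_)
open import Relation.Nullary.Negation.Core using (¬_; contradiction)

-- Rows and columns are numbered from 0, so the position (a , b) below is
-- (a + 1 , b + 1) in the usual convention.  Residues, ladders and their order
-- are unchanged by this shift.

Position : Set
Position = ℕ × ℕ

-- A weakly decreasing sequence of natural numbers with finitely many nonzero
-- terms.  Nothing below depends on which valid `bound` is chosen.

record Partition : Set where
  field
    row       : ℕ → ℕ
    row-suc   : ∀ a → row (suc a) ≤ row a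
    bound     : ℕ
    row-bound : row bound ≡ 0

open Partition public

infix 4 _∈_ _∉_

_∈_ : Position → Partition → Set
(a , b) ∈ μ = b < row μ a

_∉_ : Position → Partition → Set
p ∉ μ = ¬ (p ∈ μ)

boxes : Partition → List Position
boxes μ = concatMap (λ a → map (a ,_) (upTo (row μ a))) (upTo (bound μ))

InHook : Position → Position → Set
InHook (a , b) (c , d) = (c ≡ a × b ≤ d) ⊎ (d ≡ b × a ≤ c)

inHook? : ∀ p q → Dec (InHook p q)
inHook? (a , b) (c , d) = (c ≟ a ×-dec b ≤? d) ⊎-dec (d ≟ b ×-dec a ≤? c)

hookLength : Partition → Position → ℕ
hookLength μ p = length (filter (inHook? p) (boxes μ))

IsJM : ℕ → Partition → Set
IsJM ℓ μ = ∀ a b x y →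
  ¬ ( (a , b) ∈ μ × (a , y) ∈ μ × (x , b) ∈ μ
    × ℓ ∣ hookLength μ (a , b)
    × ℓ ∤ hookLength μ (a , y)
    × ℓ ∤ hookLength μ (x , b) )

residue : (ℓ : ℕ) .{{_ : NonZero ℓ}} → Position → ℕ
residue ℓ (a , b) = (b ⊖ a) %ℕ ℓ

-- c − a = (ℓ − 1)(b − d) holds exactly when a + (ℓ − 1) b = c + (ℓ − 1) d, so
-- this value determines the ladder; ladders go left to right as it increases.

ladderIndex : ℕ → Position → ℕ
ladderIndex ℓ (a , b) = a + (ℓ ∸ 1) * b

record Addable (μ : Partition) (p : Position) : Set where
  field
    notIn   : p ∉ μ
    added   : Partition
    diagram : ∀ q → q ∈ added ⇔ (q ∈ μ ⊎ q ≡ p)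

record Removable (μ : Partition) (p : Position) : Set where
  field
    isIn    : p ∈ μ
    removed : Partition
    diagram : ∀ q → q ∈ removed ⇔ (q ∈ μ × q ≢ p)

row-anti : ∀ μ {a b} → a ≤ b → row μ b ≤ row μ a
row-anti μ a≤b = go (≤⇒≤′ a≤b)
  where
  go : ∀ {a b} → a ≤′ b → row μ b ≤ row μ a
  go ≤′-refl            = ≤-refl
  go (≤′-step {n} a≤′n) = ≤-trans (row-suc μ n) (go a≤′n)

setRow : (ℕ → ℕ) → ℕ → ℕ → ℕ → ℕ
setRow r a v x with x ≟ a
... | yes _ = v
... | no  _ = r x

setRow-≡ : ∀ r a v → setRow r a v a ≡ v
setRow-≡ r a v with a ≟ a
... | yes _  = refl
... | no a≢a = contradiction refl a≢a

setRow-≢ : ∀ r a v {x} → x ≢ a → setRow r a v x ≡ r x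
setRow-≢ r a v {x} x≢a with x ≟ a
... | yes x≡a = contradiction x≡a x≢a
... | no _    = refl

OuterCorner : Partition → Position → Set
OuterCorner μ (zero  , b) = b ≡ row μ 0
OuterCorner μ (suc a , b) = b ≡ row μ (suc a) × b < row μ a

outerCorner? : ∀ μ p → Dec (OuterCorner μ p)
outerCorner? μ (zero  , b) = b ≟ row μ 0
outerCorner? μ (suc a , b) = b ≟ row μ (suc a) ×-dec b <? row μ a

outerCorner⇒≡ : ∀ μ a {b} → OuterCorner μ (a , b) → b ≡ row μ a
outerCorner⇒≡ μ zero    c = c
outerCorner⇒≡ μ (suc a) c = proj₁ c

outerCorner⇒addable : ∀ μ p → OuterCorner μ p → Addable μ p
outerCorner⇒addable μ (a , b) c = record
  { notIn   = <-irrefl b≡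
  ; added   = record
    { row       = r
    ; row-suc   = decreasing
    ; bound     = suc a + bound μ
    ; row-bound = trans (setRow-≢ (row μ) a (suc b) (>⇒≢ (s≤s (m≤m+n a (bound μ)))))
                        (n≤0⇒n≡0 (≤-trans (row-anti μ (m≤n+m (bound μ) (suc a)))
                                          (≤-reflexive (row-bound μ))))
    }
  ; diagram = λ q → mk⇔ (to q) (from q)
  }
  where
  b≡ = outerCorner⇒≡ μ a c
  r  = setRow (row μ) a (suc b)

  above : ∀ x → suc x ≡ a → suc b ≤ row μ x
  above x refl = proj₂ c

  decreasing : ∀ x → r (suc x) ≤ r x
  decreasing x with suc x ≟ a | x ≟ a
  ... | yes p | yes q    = ≤-refl
  ... | yes p | no _     = above x p
  ... | no _  | yes refl = ≤-trans (row-suc μ x) (≤-trans (≤-reflexive (sym b≡)) (n≤1+n b))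
  ... | no _  | no _     = row-suc μ x

  to : ∀ q → proj₂ q < r (proj₁ q) → q ∈ μ ⊎ q ≡ (a , b)
  to (x , y) y<r with x ≟ a
  ... | no _     = inj₁ y<r
  ... | yes refl with m≤n⇒m<n∨m≡n (s≤s⁻¹ y<r)
  ...   | inj₁ y<b  = inj₁ (subst (y <_) b≡ y<b)
  ...   | inj₂ refl = inj₂ refl

  from : ∀ q → q ∈ μ ⊎ q ≡ (a , b) → proj₂ q < r (proj₁ q)
  from q (inj₂ refl) = ≤-reflexive (sym (setRow-≡ (row μ) a (suc b)))
  from (x , y) (inj₁ y<) with x ≟ a
  ... | no _     = y<
  ... | yes refl = m<n⇒m<1+n (subst (y <_) (sym b≡) y<)

addable⇒outerCorner : ∀ μ p → Addable μ p → OuterCorner μ p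
addable⇒outerCorner μ (a , b) A = corner a refl
  where
  open Addable A
  open module E q = Equivalence (diagram q)

  p∈ : (a , b) ∈ added
  p∈ = from (a , b) (inj₂ refl)

  row≤b : row μ a ≤ b
  row≤b = ≮⇒≥ notIn

  b≡ : b ≡ row μ a
  b≡ with to (a , row μ a) (≤-<-trans row≤b p∈)
  ... | inj₁ row<row = contradiction row<row (<-irrefl refl)
  ... | inj₂ eq      = sym (cong proj₂ eq)

  corner : ∀ a′ → a ≡ a′ → OuterCorner μ (a′ , b)
  corner zero     refl = b≡
  corner (suc a′) refl with to (a′ , b) (<-≤-trans p∈ (row-suc added a′))
  ... | inj₁ b<row = b≡ , b<row
  ... | inj₂ eq    = contradiction (sym (cong proj₁ eq)) (1+n≢n)

addable? : ∀ μ p → Dec (Addable μ p)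
addable? μ p = map′ (outerCorner⇒addable μ p) (addable⇒outerCorner μ p) (outerCorner? μ p)

InnerCorner : Partition → Position → Set
InnerCorner μ (a , b) = suc b ≡ row μ a × row μ (suc a) ≤ b

innerCorner? : ∀ μ p → Dec (InnerCorner μ p)
innerCorner? μ (a , b) = suc b ≟ row μ a ×-dec row μ (suc a) ≤? b

innerCorner⇒removable : ∀ μ p → InnerCorner μ p → Removable μ p
innerCorner⇒removable μ (a , b) (b≡ , below) = record
  { isIn    = ≤-reflexive b≡
  ; removed = record
    { row       = r
    ; row-suc   = decreasing
    ; bound     = bound μ
    ; row-bound = trans (setRow-≢ (row μ) a b bound≢a) (row-bound μ)
    }
  ; diagram = λ q → mk⇔ (to q) (from q)
  }
  where
  r = setRow (row μ) a b

  bound≢a : bound μ ≢ a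
  bound≢a refl = contradiction (trans b≡ (row-bound μ)) λ ()

  decreasing : ∀ x → r (suc x) ≤ r x
  decreasing x with suc x ≟ a | x ≟ a
  ... | yes p    | yes q    = ≤-refl
  ... | yes refl | no _     = ≤-trans (n≤1+n b) (≤-trans (≤-reflexive b≡) (row-suc μ x))
  ... | no _     | yes refl = below
  ... | no _     | no _     = row-suc μ x

  to : ∀ q → proj₂ q < r (proj₁ q) → q ∈ μ × q ≢ (a , b)
  to (x , y) y<r with x ≟ a
  ... | no x≢a   = y<r , x≢a ∘ cong proj₁
  ... | yes refl = subst (y <_) b≡ (m<n⇒m<1+n y<r) , λ eq → <-irrefl (cong proj₂ eq) y<r

  from : ∀ q → q ∈ μ × q ≢ (a , b) → proj₂ q < r (proj₁ q)
  from (x , y) (y< , q≢) with x ≟ a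
  ... | no _     = y<
  ... | yes refl = ≤∧≢⇒< (s≤s⁻¹ (subst (y <_) (sym b≡) y<)) λ y≡b → q≢ (cong (a ,_) y≡b)

removable⇒innerCorner : ∀ μ p → Removable μ p → InnerCorner μ p
removable⇒innerCorner μ (a , b) R = ≤-antisym isIn (≮⇒≥ right) , ≮⇒≥ below
  where
  open Removable R
  open module E q = Equivalence (diagram q)

  p∉ : (a , b) ∉ removed
  p∉ p∈ = proj₂ (to (a , b) p∈) refl

  right : (a , suc b) ∉ μ
  right q∈ = p∉ (<-trans (n<1+n b) (from (a , suc b) (q∈ , 1+n≢n ∘ cong proj₂)))

  below : (suc a , b) ∉ μ
  below q∈ = p∉ (<-≤-trans (from (suc a , b) (q∈ , 1+n≢n ∘ cong proj₁)) (row-suc removed a))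

removable? : ∀ μ p → Dec (Removable μ p)
removable? μ p = map′ (innerCorner⇒removable μ p) (removable⇒innerCorner μ p) (innerCorner? μ p)

data Letter (μ : Partition) : Set where
  plus  : ∀ p → Addable μ p → Letter μ
  minus : ∀ p → Removable μ p → Letter μ

letter : ∀ μ → Position → Maybe (Letter μ)
letter μ p with addable? μ p | removable? μ p
... | yes A | _     = just (plus p A)
... | no _  | yes R = just (minus p R)
... | no _  | no _  = nothing

-- Every box and every addable position has row at most `bound` and column at
-- most the length of the first row.

window : Partition → List Position
window μ = cartesianProduct (upTo (suc (bound μ))) (upTo (suc (row μ 0)))

-- A ladder meets each row at most once, and `window` lists its positions row
-- by row, so this reads the ladder from top to bottom.

ladder : ℕ → Partition → ℕ → List Position
ladder ℓ μ n = filter (λ p → ladderIndex ℓ p ≟ n) (window μ)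

readingOrder : ℕ → Partition → List Position
readingOrder ℓ μ = concatMap (ladder ℓ μ) (upTo (suc (ladderIndex ℓ (bound μ , row μ 0))))

signature : (ℓ : ℕ) .{{_ : NonZero ℓ}} → ℕ → (μ : Partition) → List (Letter μ)
signature ℓ i μ = mapMaybe (letter μ) (filter (λ p → residue ℓ p ≟ i) (readingOrder ℓ μ))

-- Prepending − to a reduced word +⋯+−⋯− cancels its first +, if it has one;
-- prepending + leaves the word reduced.

prepend : ∀ {μ} → Letter μ → List (Letter μ) → List (Letter μ)
prepend (minus _ _) (plus _ _ ∷ w) = w
prepend x           w              = x ∷ w

reduce : ∀ {μ} → List (Letter μ) → List (Letter μ)
reduce = foldr prepend []

reducedSignature : (ℓ : ℕ) .{{_ : NonZero ℓ}} → ℕ → (μ : Partition) → List (Letter μ)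
reducedSignature ℓ i μ = reduce (signature ℓ i μ)

pluses : ∀ {μ} → List (Letter μ) → List (∃ (Addable μ))
pluses []              = []
pluses (plus p A  ∷ w) = (p , A) ∷ pluses w
pluses (minus _ _ ∷ w) = pluses w

minuses : ∀ {μ} → List (Letter μ) → List (∃ (Removable μ))
minuses []              = []
minuses (plus _ _  ∷ w) = minuses w
minuses (minus p R ∷ w) = (p , R) ∷ minuses w

module _ (ℓ : ℕ) .{{_ : NonZero ℓ}} (i : ℕ) where

  φ̂ : Partition → ℕ
  φ̂ μ = length (pluses (reducedSignature ℓ i μ))

  ε̂ : Partition → ℕ
  ε̂ μ = length (minuses (reducedSignature ℓ i μ))

  -- The value 0 of the operators is `nothing`.

  f̂ : Partition → Maybe Partition
  f̂ μ = Maybe.map (Addable.added ∘ proj₂) (last (pluses (reducedSignature ℓ i μ)))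

  ê : Partition → Maybe Partition
  ê μ = Maybe.map (Removable.removed ∘ proj₂) (head (minuses (reducedSignature ℓ i μ)))

infixl 8 _^⟨_⟩_

_^⟨_⟩_ : ∀ {A : Set} → (A → Maybe A) → ℕ → A → Maybe A
op ^⟨ zero  ⟩ x = just x
op ^⟨ suc n ⟩ x = op x >>= (op ^⟨ n ⟩_)

{-# OPTIONS --safe #-}
module Submission where

-- Encode a partition by its Maya diagram: the rows give beads, the columns gaps, and the hook
-- length of a box is the distance from the gap of its column to the bead of its row.  Being
-- (ℓ,0)-JM says that for every gap g below a bead β with g ≡ β (mod ℓ), all gaps below β or all
-- beads above g lie in the same residue class.
--
-- If p is an addable and q a removable i-box of an (ℓ,0)-JM partition, then the box where the row
-- of the upper one meets the column of the lower one has hook length divisible by ℓ, while q has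
-- hook length 1.  So all hook lengths of a whole row or column segment between them are
-- multiples of ℓ, which makes that hook long enough to force p to be read before q.  Nothing
-- cancels in the signature, hence the powers of f̂ and ê add all addable, respectively remove
-- all removable, i-boxes.  On the Maya diagram this sorts each pair of neighbouring positions
-- in two adjacent residue classes, and every violation of the JM condition after sorting
-- comes from one before.

open import Defs
open import Data.Empty using (⊥)
open import Data.Integer.Base using (-[1+_])
open import Data.Integer.DivMod using (_%ℕ_)
open import Data.Integer.Properties using ([1+m]⊖[1+n]≡m⊖n)
open import Data.List.Base
  using ( List; []; _∷_; _∷ʳ_; _++_; initLast; _∷ʳ′_
        ; cartesianProduct; concatMap; filter; last; length; map; mapMaybe; upTo)
open import Data.List.Membership.Propositional using () renaming (_∈_ to _∈ˡ_)
open import Data.List.Membership.Propositional.Properties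
open import Data.List.Properties
  using (concatMap-++; filter-++; filter-accept; filter-reject; length-++; length-map; map-++; ++-identityʳ; upTo-∷ʳ)
open import Data.List.Relation.Unary.All as All using (All; []; _∷_)
import Data.List.Relation.Unary.All.Properties as All
open import Data.List.Relation.Unary.AllPairs as AllPairs using (AllPairs; []; _∷_)
import Data.List.Relation.Unary.AllPairs.Properties as AllPairs
open import Data.List.Relation.Unary.Any as Any using (here; there)
open import Data.Maybe.Base as Maybe using (just; _>>=_)
open import Data.Nat.Base
open import Data.Nat.Divisibility
open import Data.Nat.DivMod
open import Data.Nat.Properties
open import Data.Nat.Tactic.RingSolver using (solve-∀)
open import Data.Product.Base using (_×_; _,_; ∃-syntax; proj₁; proj₂)
open import Data.Product.Properties using (≡-dec)
open import Data.Sum.Base using (_⊎_; inj₁; inj₂)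
open import Data.Unit.Base using (⊤; tt)
open import Function.Base using (_∘_; case_of_; id)
open import Function.Bundles using (_⇔_; mk⇔; module Equivalence)
open import Relation.Binary.PropositionalEquality
open import Relation.Nullary.Decidable using (Dec; yes; no; decidable-stable; _×-dec_)
open import Relation.Nullary.Negation.Core using (¬_; contradiction)
open Equivalence using (to; from)

-- Residues

module _ (ℓ : ℕ) .{{_ : NonZero ℓ}} where

  %-congʳ-+ : ∀ k {m n} → m % ℓ ≡ n % ℓ → (k + m) % ℓ ≡ (k + n) % ℓ
  %-congʳ-+ k {m} {n} eq = begin
    (k + m) % ℓ          ≡⟨ %-distribˡ-+ k m ℓ ⟩
    (k % ℓ + m % ℓ) % ℓ  ≡⟨ cong (λ r → (k % ℓ + r) % ℓ) eq ⟩
    (k % ℓ + n % ℓ) % ℓ  ≡⟨ %-distribˡ-+ k n ℓ ⟨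
    (k + n) % ℓ          ∎
    where open ≡-Reasoning

  -- Adding ℓ - 1 undoes a successor modulo ℓ.
  suc-%-injective : ∀ {m n} → suc m % ℓ ≡ suc n % ℓ → m % ℓ ≡ n % ℓ
  suc-%-injective {m} {n} eq = trans (sym (shift m)) (trans (%-congʳ-+ (pred ℓ) eq) (shift n))
    where
    shift : ∀ k → (pred ℓ + suc k) % ℓ ≡ k % ℓ
    shift k = trans (%-congˡ (trans (+-suc (pred ℓ) k)
                                    (trans (cong (_+ k) (suc-pred ℓ)) (+-comm ℓ k))))
                    ([m+n]%n≡m%n k ℓ)

  +-%-cancelˡ : ∀ k {m n} → (k + m) % ℓ ≡ (k + n) % ℓ → m % ℓ ≡ n % ℓ
  +-%-cancelˡ zero    eq = eq
  +-%-cancelˡ (suc k) eq = +-%-cancelˡ k (suc-%-injective eq)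

  suc-%-≢ : 2 ≤ ℓ → ∀ n → suc n % ℓ ≢ n % ℓ
  suc-%-≢ 2≤ℓ n eq = contradiction
    (trans (sym (m<n⇒m%n≡m 2≤ℓ))
      (trans (+-%-cancelˡ n (trans (cong (_% ℓ) (+-comm n 1))
                                   (trans eq (cong (_% ℓ) (sym (+-identityʳ n))))))
             (m<n⇒m%n≡m (≤-trans (s≤s z≤n) 2≤ℓ))))
    λ ()

  ∣⇒%≡ : ∀ m {n} → ℓ ∣ n → (m + n) % ℓ ≡ m % ℓ
  ∣⇒%≡ m = %-remove-+ʳ m

  %≡⇒∣ : ∀ m {n} → (m + n) % ℓ ≡ m % ℓ → ℓ ∣ n
  %≡⇒∣ m {n} eq = m%n≡0⇒n∣m n ℓ
    (trans (+-%-cancelˡ m (trans eq (cong (_% ℓ) (sym (+-identityʳ m))))) (m<n⇒m%n≡m (>-nonZero⁻¹ ℓ)))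

  -- Here `z` is a natural number congruent to -(n + 1). The case split follows the definition of
  -- `_%ℕ_` at a negative integer, whose value is 0 or `ℓ ∸ suc r` according to the remainder of
  -- `suc n`.
  -[1+n]%ℕ : ∀ {z n} m → z + suc n ≡ m * ℓ → -[1+ n ] %ℕ ℓ ≡ z % ℓ
  -[1+n]%ℕ {z} {n} m eq with suc n % ℓ in r≡ | m≡m%n+[m/n]*n (suc n) ℓ
  ... | zero  | n≡ = begin
    0                            ≡⟨ m*n%n≡0 m ℓ ⟨
    m * ℓ % ℓ                    ≡⟨ cong (_% ℓ) eq ⟨
    (z + suc n) % ℓ              ≡⟨ cong (λ k → (z + k) % ℓ) n≡ ⟩
    (z + suc n / ℓ * ℓ) % ℓ      ≡⟨ [m+kn]%n≡m%n z (suc n / ℓ) ℓ ⟩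
    z % ℓ                        ∎
    where open ≡-Reasoning
  ... | suc r | n≡ = begin
    t                            ≡⟨ m<n⇒m%n≡m (∸-monoʳ-< z<s r<ℓ) ⟨
    t % ℓ                        ≡⟨ [m+kn]%n≡m%n t m ℓ ⟨
    (t + m * ℓ) % ℓ              ≡⟨ cong (λ k → (t + k) % ℓ) (trans (sym eq) (cong (z +_) n≡)) ⟩
    (t + (z + (suc r + q * ℓ))) % ℓ ≡⟨ cong (_% ℓ) (lemma t z (suc r) (q * ℓ)) ⟩
    (z + ((t + suc r) + q * ℓ)) % ℓ ≡⟨ cong (λ k → (z + (k + q * ℓ)) % ℓ) (m∸n+n≡m r<ℓ) ⟩
    (z + suc q * ℓ) % ℓ          ≡⟨ [m+kn]%n≡m%n z (suc q) ℓ ⟩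
    z % ℓ                        ∎
    where
    open ≡-Reasoning
    t = ℓ ∸ suc r
    q = suc n / ℓ
    r<ℓ : suc r ≤ ℓ
    r<ℓ = <⇒≤ (subst (_< ℓ) r≡ (m%n<n (suc n) ℓ))
    lemma : ∀ t z r q → t + (z + (r + q)) ≡ z + ((t + r) + q)
    lemma = solve-∀

  -- A multiple of ℓ is added to the content b − a to make it a natural number.
  residue-shift : ∀ m a b {z} → z + a ≡ b + m * ℓ → residue ℓ (a , b) ≡ z % ℓ
  residue-shift m zero    b       eq = sym (trans (cong (_% ℓ) (trans (sym (+-identityʳ _)) eq)) ([m+kn]%n≡m%n b m ℓ))
  residue-shift m (suc a) zero    eq = -[1+n]%ℕ m eq
  residue-shift m (suc a) (suc b) {z} eq =
    trans (cong (_%ℕ ℓ) ([1+m]⊖[1+n]≡m⊖n b a))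
          (residue-shift m a b (suc-injective (trans (sym (+-suc z a)) eq)))

  -- Shifting by `a * ℓ` makes the content b - a nonnegative for every `b`, since a ≤ aℓ.
  diagonal : ∀ a b → ∃[ z ] z + a ≡ b + a * ℓ
  diagonal a b = b + a * ℓ ∸ a , m∸n+n≡m (≤-trans (m≤m*n a ℓ) (m≤n+m (a * ℓ) b))

-- Maya diagrams

Adjacent : ℕ → ℕ → Set
Adjacent z z̄ = z ≡ suc z̄ ⊎ z̄ ≡ suc z

-- A step of length one can reach `w` but not jump over it, so excluding equality preserves the
-- order.
adjacent-<ˡ : ∀ {z z̄ w} → Adjacent z z̄ → z < w → z̄ ≢ w → z̄ < w
adjacent-<ˡ (inj₁ refl) z<w _   = <-trans (n<1+n _) z<w
adjacent-<ˡ (inj₂ refl) z<w z̄≢w = ≤∧≢⇒< z<w z̄≢w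

adjacent-<ʳ : ∀ {z w w̄} → Adjacent w w̄ → z < w → z ≢ w̄ → z < w̄
adjacent-<ʳ (inj₁ refl) z<w z≢w̄ = ≤∧≢⇒< (s≤s⁻¹ z<w) z≢w̄
adjacent-<ʳ (inj₂ refl) z<w _   = m<n⇒m<1+n z<w

module _ (ℓ : ℕ) .{{_ : NonZero ℓ}} where

  -- In terms of the boxes (a,b), (a,y), (x,b) of a violation: `g` and `g′` are the gaps of columns
  -- b and y, `β` and `β′` the beads of rows a and x. The three inequalities say that the boxes lie
  -- in the diagram.
  JMaya : (Bead Gap : ℕ → Set) → Set
  JMaya Bead Gap = ∀ {g β g′ β′} → Gap g → Bead β → Gap g′ → Bead β′ →
    g < β → g′ < β → g < β′ →
    g % ℓ ≡ β % ℓ → g′ % ℓ ≢ β % ℓ → β′ % ℓ ≢ g % ℓ → ⊥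

  -- A pair of neighbouring residue classes; z̄ is the neighbour of z in the other class.

  Mate : (ℕ → Set) → ℕ → ℕ → Set
  Mate P c z = ∃[ z̄ ] Adjacent z z̄ × z̄ % ℓ ≡ c × P z̄

  -- In each pair of neighbours, one of class r and one of class s, the primed diagram holds a
  -- bead at s before it holds one at r.  At 0 the neighbour may be missing.

  record Toggle (r s : ℕ) (Bead Gap Bead′ Gap′ : ℕ → Set) : Set where
    field
      r≢s      : r ≢ s
      disjoint : ∀ {z} → Bead z → ¬ Gap z
      bead-off : ∀ {z} → 0 < z → z % ℓ ≢ r → z % ℓ ≢ s → Bead′ z → Bead z
      gap-off  : ∀ {z} → z % ℓ ≢ r → z % ℓ ≢ s → Gap′ z → Gap z
      bead-r   : ∀ {z} → 0 < z → z % ℓ ≡ r → Bead′ z → Bead z × Mate Bead s z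
      gap-r    : ∀ {z} → z % ℓ ≡ r → Gap′ z → Gap z ⊎ Mate Gap s z
      bead-s   : ∀ {z} → 0 < z → z % ℓ ≡ s → Bead′ z → Bead z ⊎ Mate Bead r z
      gap-s    : ∀ {z} → z % ℓ ≡ s → Gap′ z → Gap z × Mate Gap r z

  module _ {r s Bead Gap Bead′ Gap′} (T : Toggle r s Bead Gap Bead′ Gap′) (J : JMaya Bead Gap) where
    open Toggle T

    private
      %≢⇒≢ : ∀ {m n} → m % ℓ ≢ n % ℓ → m ≢ n
      %≢⇒≢ m≢n refl = m≢n refl

      separate : ∀ {z w c d} → c ≢ d → z % ℓ ≡ c → w % ℓ ≡ d → z % ℓ ≢ w % ℓ
      separate c≢d z≡ w≡ eq = c≢d (trans (sym z≡) (trans eq w≡))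

      disjoint-≢ : ∀ {g β} → Gap g → Bead β → g ≢ β
      disjoint-≢ G B refl = disjoint B G

      s≢r = r≢s ∘ sym

      0<_ : ∀ {m n} → m < n → 0 < n
      0<_ = ≤-<-trans z≤n

      -- At worst sorting has moved the gap from its mate in class `s`. As `w` is in neither class,
      -- the mate differs from `w`, hence stays below it, and is still of another class.
      some-gap : ∀ {g w} → w % ℓ ≢ r → w % ℓ ≢ s → Gap′ g → g < w → g % ℓ ≢ w % ℓ →
        ∃[ h ] Gap h × h < w × h % ℓ ≢ w % ℓ
      some-gap {g} {w} w≢r w≢s G g<w g≢w with g % ℓ ≟ r | g % ℓ ≟ s
      ... | no g≢r  | no g≢s = g , gap-off g≢r g≢s G , g<w , g≢w
      ... | _       | yes g≡s = g , proj₁ (gap-s g≡s G) , g<w , g≢w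
      ... | yes g≡r | no _ with gap-r g≡r G
      ...   | inj₁ G₁ = g , G₁ , g<w , g≢w
      ...   | inj₂ (h , adj , h≡s , G₁) = h , G₁ , adjacent-<ˡ adj g<w (%≢⇒≢ h≢w) , h≢w
        where h≢w = λ e → w≢s (trans (sym e) h≡s)

      some-bead : ∀ {β w} → w % ℓ ≢ r → w % ℓ ≢ s → Bead′ β → w < β → β % ℓ ≢ w % ℓ →
        ∃[ h ] Bead h × w < h × h % ℓ ≢ w % ℓ
      some-bead {β} {w} w≢r w≢s B w<β β≢w with β % ℓ ≟ r | β % ℓ ≟ s
      ... | no β≢r  | no β≢s = β , bead-off (0< w<β) β≢r β≢s B , w<β , β≢w
      ... | yes β≡r | _ = β , proj₁ (bead-r (0< w<β) β≡r B) , w<β , β≢w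
      ... | no _    | yes β≡s with bead-s (0< w<β) β≡s B
      ...   | inj₁ B₁ = β , B₁ , w<β , β≢w
      ...   | inj₂ (h , adj , h≡r , B₁) = h , B₁ , adjacent-<ʳ adj w<β (%≢⇒≢ (h≢w ∘ sym)) , h≢w
        where h≢w = λ e → w≢r (trans (sym e) h≡r)

    -- A violation after sorting gives one before, depending on the common class of `g` and `β`.
    -- Outside both classes the pair itself survives. In class `r`, both `β` and its mate `β̄` were
    -- beads: if `g` was a gap, `g` and `β` violate the condition with `β̄` as the bead of another
    -- class; otherwise `ḡ` was a gap, and `ḡ` and `β̄` violate it with `β` as that bead. Class `s`
    -- is dual, with `ḡ` or `g` as the gap of another class.
    toggle-JMaya : JMaya Bead′ Gap′
    toggle-JMaya {g} {β} {g′} {β′} G B G′ B′ g<β g′<β g<β′ g≡β g′≢β β′≢g with β % ℓ ≟ r | β % ℓ ≟ s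
    ... | no β≢r | no β≢s =
      let _ , G₁ , <₁ , ≢₁ = some-gap β≢r β≢s G′ g′<β g′≢β
          g≢r = β≢r ∘ trans (sym g≡β)
          g≢s = β≢s ∘ trans (sym g≡β)
          _ , B₁ , <₂ , ≢₂ = some-bead g≢r g≢s B′ g<β′ β′≢g
      in J (gap-off g≢r g≢s G) (bead-off (0< g<β) β≢r β≢s B) G₁ B₁ g<β <₁ <₂ g≡β ≢₁ ≢₂
    ... | yes β≡r | _ with bead-r (0< g<β) β≡r B | gap-r (trans g≡β β≡r) G
    ...   | B₀ , β̄ , adj , β̄≡s , B̄ | inj₁ G₀ =
      let _ , G₁ , <₁ , ≢₁ = witness in J G₀ B₀ G₁ B̄ g<β <₁ g<β̄ g≡β ≢₁ (separate s≢r β̄≡s g≡r)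
      where
      g≡r = trans g≡β β≡r
      g<β̄ = adjacent-<ʳ adj g<β (%≢⇒≢ (separate r≢s g≡r β̄≡s))
      witness : ∃[ h ] Gap h × h < β × h % ℓ ≢ β % ℓ
      witness with g′ % ℓ ≟ s
      ... | yes g′≡s = g′ , proj₁ (gap-s g′≡s G′) , g′<β , g′≢β
      ... | no g′≢s  = g′ , gap-off (λ e → g′≢β (trans e (sym β≡r))) g′≢s G′ , g′<β , g′≢β
    ...   | B₀ , β̄ , adjβ , β̄≡s , B̄ | inj₂ (ḡ , adj , ḡ≡s , Ḡ) =
      let _ , G₁ , <₁ , ≢₁ = witness in J Ḡ B̄ G₁ B₀ ḡ<β̄ <₁ ḡ<β (trans ḡ≡s (sym β̄≡s)) ≢₁ (separate r≢s β≡r ḡ≡s)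
      where
      ḡ<β = adjacent-<ˡ adj g<β (%≢⇒≢ (separate s≢r ḡ≡s β≡r))
      -- Both lie in class `s`, so residues cannot separate them; they differ because one is a gap
      -- and the other a bead.
      ḡ<β̄ = adjacent-<ʳ adjβ ḡ<β (disjoint-≢ Ḡ B̄)
      witness : ∃[ h ] Gap h × h < β̄ × h % ℓ ≢ β̄ % ℓ
      witness with g′ % ℓ ≟ s
      ... | no g′≢s =
        g′ , gap-off (λ e → g′≢β (trans e (sym β≡r))) g′≢s G′ ,
        adjacent-<ʳ adjβ g′<β (%≢⇒≢ g′≢β̄) , g′≢β̄
        where g′≢β̄ = λ e → g′≢s (trans e β̄≡s)
      -- Now `g′` is in the class of `β̄`, so its mate in class `r` takes its place.
      ... | yes g′≡s with gap-s g′≡s G′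
      ...   | G₁ , h , adjh , h≡r , Gh = h , Gh , adjacent-<ʳ adjβ h<β (disjoint-≢ Gh B̄) , separate r≢s h≡r β̄≡s
        where h<β = adjacent-<ˡ adjh g′<β (disjoint-≢ Gh B₀)
    toggle-JMaya {g} {β} {g′} {β′} G B G′ B′ g<β g′<β g<β′ g≡β g′≢β β′≢g
        | no _ | yes β≡s with gap-s (trans g≡β β≡s) G | bead-s (0< g<β) β≡s B
    ...   | G₀ , ḡ , adj , ḡ≡r , Ḡ | inj₁ B₀ =
      let _ , B₁ , <₁ , ≢₁ = witness in J G₀ B₀ Ḡ B₁ g<β ḡ<β <₁ g≡β (separate r≢s ḡ≡r β≡s) ≢₁
      where
      ḡ<β = adjacent-<ˡ adj g<β (%≢⇒≢ (separate r≢s ḡ≡r β≡s))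
      witness : ∃[ h ] Bead h × g < h × h % ℓ ≢ g % ℓ
      witness with β′ % ℓ ≟ r
      ... | yes β′≡r = β′ , proj₁ (bead-r (0< g<β′) β′≡r B′) , g<β′ , β′≢g
      ... | no β′≢r  = β′ , bead-off (0< g<β′) β′≢r β′≢s B′ , g<β′ , β′≢g
        where β′≢s = λ e → β′≢g (trans e (sym (trans g≡β β≡s)))
    ...   | G₀ , ḡ , adj , ḡ≡r , Ḡ | inj₂ (β̄ , adjβ , β̄≡r , B̄) =
      let _ , B₁ , <₁ , ≢₁ = witness in J Ḡ B̄ G₀ B₁ ḡ<β̄ g<β̄ <₁ (trans ḡ≡r (sym β̄≡r)) (separate s≢r g≡s β̄≡r) ≢₁
      where
      g≡s = trans g≡β β≡s
      g<β̄ = adjacent-<ʳ adjβ g<β (%≢⇒≢ (separate s≢r g≡s β̄≡r))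
      ḡ<β̄ = adjacent-<ˡ adj g<β̄ (disjoint-≢ Ḡ B̄)
      witness : ∃[ h ] Bead h × ḡ < h × h % ℓ ≢ ḡ % ℓ
      witness with β′ % ℓ ≟ r
      ... | no β′≢r =
        β′ , bead-off (0< g<β′) β′≢r (λ e → β′≢g (trans e (sym g≡s))) B′ ,
        adjacent-<ˡ adj g<β′ (%≢⇒≢ (β′≢ḡ ∘ sym)) , β′≢ḡ
        where β′≢ḡ = λ e → β′≢r (trans e ḡ≡r)
      ... | yes β′≡r with bead-r (0< g<β′) β′≡r B′
      ...   | B₁ , h , adjh , h≡s , Bh = h , Bh , adjacent-<ˡ adj g<h (disjoint-≢ Ḡ Bh) , separate s≢r h≡s ḡ≡r
        where g<h = adjacent-<ʳ adjh g<β′ (disjoint-≢ G₀ Bh)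

-- Hook lengths

-- The part of addability that concerns the box directly above, vacuous in the top row.
UpIn : Partition → ℕ → ℕ → Set
UpIn μ zero    b = ⊤
UpIn μ (suc a) b = b < row μ a

-- `c` is the length of column `b`, that is, a part of the conjugate partition.
Height : Partition → ℕ → ℕ → Set
Height μ b c = UpIn μ c b × row μ c ≤ b

upIn-above : ∀ μ {b c x} → UpIn μ c b → x < c → b < row μ x
upIn-above μ {c = suc c} up x<c = <-≤-trans up (row-anti μ (s≤s⁻¹ x<c))

height-< : ∀ μ {b c x} → Height μ b c → b < row μ x → x < c
height-< μ (_ , row≤b) b<row = ≰⇒> λ c≤x → <-irrefl refl (<-≤-trans b<row (≤-trans (row-anti μ c≤x) row≤b))

height : ∀ μ b → ∃[ c ] Height μ b c
height μ b = search (bound μ) λ _ → ≤-trans (≤-reflexive (row-bound μ)) z≤n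
  where
  -- The search climbs from row `bound μ`, which is empty, until the row above reaches past column
  -- `b`.
  search : ∀ n → (⊤ → row μ n ≤ b) → ∃[ c ] Height μ b c
  search zero    row≤b = zero , tt , row≤b tt
  search (suc n) row≤b with row μ n ≤? b
  ... | yes below = search n λ _ → below
  ... | no  above = suc n , ≰⇒> above , row≤b tt

height≤bound : ∀ μ {b c} → Height μ b c → c ≤ bound μ
height≤bound μ {c = zero}  _        = z≤n
height≤bound μ {b} {suc c} (up , _) = ≰⇒> λ bound≤c →
  n≮0 (<-≤-trans up (≤-trans (row-anti μ bound≤c) (≤-reflexive (row-bound μ))))

module _ (μ : Partition) {a b c : ℕ} (h : Height μ b c) (b<row : b < row μ a) where

  private
    hook? = inHook? (a , b)

    inHook : List Position → ℕ
    inHook ps = length (filter hook? ps)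

    inHook-++ : ∀ ps qs → inHook (ps ++ qs) ≡ inHook ps + inHook qs
    inHook-++ ps qs = trans (cong length (filter-++ hook? ps qs)) (length-++ (filter hook? ps))

    prefix : ℕ → ℕ → List Position
    prefix x n = map (x ,_) (upTo n)

    prefix-suc : ∀ x n → inHook (prefix x (suc n)) ≡ inHook (prefix x n) + inHook ((x , n) ∷ [])
    prefix-suc x n = trans (cong (inHook ∘ map (x ,_)) (sym (upTo-∷ʳ n)))
      (trans (cong inHook (map-++ (x ,_) (upTo n) (n ∷ []))) (inHook-++ (prefix x n) _))

    prefix-in : ∀ x n → InHook (a , b) (x , n) → inHook (prefix x (suc n)) ≡ suc (inHook (prefix x n))
    prefix-in x n p = trans (prefix-suc x n)
      (trans (cong (λ w → inHook (prefix x n) + length w) (filter-accept hook? p)) (+-comm _ 1))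

    prefix-out : ∀ x n → ¬ InHook (a , b) (x , n) → inHook (prefix x (suc n)) ≡ inHook (prefix x n)
    prefix-out x n p = trans (prefix-suc x n)
      (trans (cong (λ w → inHook (prefix x n) + length w) (filter-reject hook? p)) (+-identityʳ _))

    row-above : ∀ {x} → x < a → ∀ n → inHook (prefix x n) ≡ 0
    row-above x<a zero    = refl
    row-above x<a (suc n) = trans (prefix-out _ n λ { (inj₁ (x≡a , _)) → <⇒≢ x<a x≡a
                                                    ; (inj₂ (_ , a≤x)) → <⇒≱ x<a a≤x })
                                  (row-above x<a n)

    row-left : ∀ x n → n ≤ b → inHook (prefix x n) ≡ 0
    row-left x zero    _   = refl
    row-left x (suc n) n<b = trans (prefix-out x n λ { (inj₁ (_ , b≤n)) → <⇒≱ n<b b≤n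
                                                   ; (inj₂ (n≡b , _)) → <⇒≢ n<b n≡b })
                                 (row-left x n (<⇒≤ n<b))

    arm : ∀ k → inHook (prefix a (b + k)) ≡ k
    arm zero    = row-left a (b + 0) (≤-reflexive (+-identityʳ b))
    arm (suc k) = trans (cong (inHook ∘ prefix a) (+-suc b k))
                        (trans (prefix-in a (b + k) (inj₁ (refl , m≤m+n b k))) (cong suc (arm k)))

    row-below : ∀ {x} → a < x → ∀ k → inHook (prefix x (suc b + k)) ≡ 1
    row-below {x} a<x zero    = trans (cong (inHook ∘ prefix x ∘ suc) (+-identityʳ b))
      (trans (prefix-in x b (inj₂ (refl , <⇒≤ a<x))) (cong suc (row-left x b ≤-refl)))
    row-below {x} a<x (suc k) = trans (cong (inHook ∘ prefix x) (+-suc (suc b) k))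
      (trans (prefix-out x (suc b + k) λ { (inj₁ (x≡a , _)) → >⇒≢ a<x x≡a
                                         ; (inj₂ (e , _)) → m≢1+m+n b (sym e) })
             (row-below a<x k))

    rows : ℕ → List Position
    rows n = concatMap (λ x → prefix x (row μ x)) (upTo n)

    rows-suc : ∀ n → inHook (rows (suc n)) ≡ inHook (rows n) + inHook (prefix n (row μ n))
    rows-suc n = trans (cong (inHook ∘ concatMap (λ x → prefix x (row μ x))) (sym (upTo-∷ʳ n)))
      (trans (cong inHook (concatMap-++ (λ x → prefix x (row μ x)) (upTo n) (n ∷ [])))
      (trans (inHook-++ (rows n) _)
             (cong (λ ps → inHook (rows n) + inHook ps) (++-identityʳ (prefix n (row μ n))))))

    above : ∀ n → n ≤ a → inHook (rows n) ≡ 0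
    above zero    _   = refl
    above (suc n) n<a = trans (rows-suc n) (cong₂ _+_ (above n (<⇒≤ n<a)) (row-above n<a (row μ n)))

    -- The corner box is counted with row `a`; each further row that reaches column `b` contributes
    -- only its box in that column.
    leg : ∀ k → suc a + k ≤ c → inHook (rows (suc a + k)) ≡ (row μ a ∸ b) + k
    leg zero    a<c = trans (cong (inHook ∘ rows ∘ suc) (+-identityʳ a))
      (trans (rows-suc a) (trans (cong (_+ inHook (prefix a (row μ a))) (above a ≤-refl))
      (trans (trans (cong (inHook ∘ prefix a) (sym (m+[n∸m]≡n (<⇒≤ b<row)))) (arm (row μ a ∸ b)))
             (sym (+-identityʳ _)))))
    leg (suc k) x<c = trans (cong (inHook ∘ rows) (+-suc (suc a) k))
      (trans (rows-suc (suc a + k))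
      (trans (cong₂ _+_ (leg k (<⇒≤ x<c′))
                        (trans (cong (inHook ∘ prefix (suc a + k)) (sym (m+[n∸m]≡n (upIn-above μ (proj₁ h) x<c′))))
                               (row-below (s≤s (m≤m+n a k)) _)))
             (trans (+-assoc (row μ a ∸ b) k 1) (cong ((row μ a ∸ b) +_) (+-comm k 1)))))
      where
      x<c′ : suc a + k < c
      x<c′ = subst (_≤ c) (+-suc (suc a) k) x<c

    below : ∀ k → inHook (rows (c + k)) ≡ inHook (rows c)
    below zero    = cong (inHook ∘ rows) (+-identityʳ c)
    below (suc k) = trans (cong (inHook ∘ rows) (+-suc c k))
      (trans (rows-suc (c + k))
      (trans (cong₂ _+_ (below k) (row-left (c + k) (row μ (c + k)) (≤-trans (row-anti μ (m≤m+n c k)) (proj₂ h))))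
             (+-identityʳ _)))

  -- This is arm + leg + 1 without subtraction. The list of boxes is counted row by row: nothing
  -- above row `a`, the arm with the corner in row `a`, one box per row down to the end of column
  -- `b`, and nothing below.
  hookLength-height : hookLength μ (a , b) + suc (a + b) ≡ row μ a + c
  hookLength-height = begin
    hookLength μ (a , b) + suc (a + b)             
      ≡⟨ cong (λ n → inHook (rows n) + suc (a + b)) (m+[n∸m]≡n (height≤bound μ h)) ⟨
    inHook (rows (c + (bound μ ∸ c))) + suc (a + b) ≡⟨ cong (_+ suc (a + b)) (below (bound μ ∸ c)) ⟩
    inHook (rows c) + suc (a + b)                  ≡⟨ cong (λ n → inHook (rows n) + suc (a + b)) (m+[n∸m]≡n a<c) ⟨
    inHook (rows (suc a + k)) + suc (a + b)        ≡⟨ cong (_+ suc (a + b)) (leg k (≤-reflexive (m+[n∸m]≡n a<c))) ⟩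
    ((row μ a ∸ b) + k) + suc (a + b)              ≡⟨ rearrange (row μ a ∸ b) k a b ⟩
    ((row μ a ∸ b) + b) + (suc a + k)              ≡⟨ cong₂ _+_ (m∸n+n≡m (<⇒≤ b<row)) (m+[n∸m]≡n a<c) ⟩
    row μ a + c                                    ∎
    where
    open ≡-Reasoning
    a<c = height-< μ h b<row
    k   = c ∸ suc a
    rearrange : ∀ r k a b → (r + k) + suc (a + b) ≡ (r + b) + (suc a + k)
    rearrange = solve-∀

outerCorner⇒upIn : ∀ μ a {b} → OuterCorner μ (a , b) → UpIn μ a b
outerCorner⇒upIn μ zero    _ = tt
outerCorner⇒upIn μ (suc a) o = proj₂ o

upIn⇒outerCorner : ∀ μ a {b} → b ≡ row μ a → UpIn μ a b → OuterCorner μ (a , b)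
upIn⇒outerCorner μ zero    b≡ _  = b≡
upIn⇒outerCorner μ (suc a) b≡ up = b≡ , up

height-anti : ∀ μ {b c c′} → Height μ b c → Height μ (suc b) c′ → c′ ≤ c
height-anti μ h (up , _) = ≮⇒≥ λ c<c′ → <⇒≱ (upIn-above μ up c<c′) (m≤n⇒m≤1+n (proj₂ h))

hookLength-positive : ∀ μ {a b c} → Height μ b c → b < row μ a → 0 < hookLength μ (a , b)
hookLength-positive μ {a} {b} {c} h b<row = +-cancelʳ-< (suc (a + b)) 0 _ (begin-strict
  suc (a + b)                         ≡⟨ +-comm (suc a) b ⟩
  b + suc a                           <⟨ +-monoˡ-< (suc a) b<row ⟩
  row μ a + suc a                     ≤⟨ +-monoʳ-≤ (row μ a) (height-< μ h b<row) ⟩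
  row μ a + c                         ≡⟨ hookLength-height μ h b<row ⟨
  hookLength μ (a , b) + suc (a + b)  ∎)
  where open ≤-Reasoning

-- Together with `hookLength-right`, this supplies the strict descent along a column or row that
-- `multiples-descent` turns into a long hook.
hookLength-down : ∀ μ {a b c} → Height μ b c → b < row μ (suc a) → hookLength μ (suc a , b) < hookLength μ (a , b)
hookLength-down μ {a} {b} {c} h b<row = +-cancelʳ-≤ (suc (a + b)) _ _ (begin
  suc (hookLength μ (suc a , b)) + suc (a + b) ≡⟨ +-suc (hookLength μ (suc a , b)) (suc (a + b)) ⟨
  hookLength μ (suc a , b) + suc (suc a + b)   ≡⟨ hookLength-height μ h b<row ⟩
  row μ (suc a) + c                            ≤⟨ +-monoˡ-≤ c (row-suc μ a) ⟩
  row μ a + c                                  ≡⟨ hookLength-height μ h (<-≤-trans b<row (row-suc μ a)) ⟨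
  hookLength μ (a , b) + suc (a + b)           ∎)
  where open ≤-Reasoning

hookLength-right : ∀ μ {a b} → suc b < row μ a → hookLength μ (a , suc b) < hookLength μ (a , b)
hookLength-right μ {a} {b} b<row with height μ b | height μ (suc b)
... | c , h | c′ , h′ = +-cancelʳ-≤ (suc (a + b)) _ _ (begin
  suc (hookLength μ (a , suc b)) + suc (a + b) ≡⟨ +-suc (hookLength μ (a , suc b)) (suc (a + b)) ⟨
  hookLength μ (a , suc b) + suc (suc (a + b)) ≡⟨ cong (λ n → hookLength μ (a , suc b) + suc n) (+-suc a b) ⟨
  hookLength μ (a , suc b) + suc (a + suc b)   ≡⟨ hookLength-height μ h′ b<row ⟩
  row μ a + c′                                 ≤⟨ +-monoʳ-≤ (row μ a) (height-anti μ h h′) ⟩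
  row μ a + c                                  ≡⟨ hookLength-height μ h (<-trans (n<1+n b) b<row) ⟨
  hookLength μ (a , b) + suc (a + b)           ∎)
  where open ≤-Reasoning

innerCorner⇒height : ∀ μ {a b} → InnerCorner μ (a , b) → Height μ b (suc a)
innerCorner⇒height μ (b≡ , below) = ≤-reflexive b≡ , below

innerCorner⇒hookLength : ∀ μ {a b} → InnerCorner μ (a , b) → hookLength μ (a , b) ≡ 1
innerCorner⇒hookLength μ {a} {b} ic@(b≡ , _) = +-cancelʳ-≡ (suc (a + b)) _ _ (begin
  hookLength μ (a , b) + suc (a + b) ≡⟨ hookLength-height μ (innerCorner⇒height μ ic) (≤-reflexive b≡) ⟩
  row μ a + suc a                    ≡⟨ cong (_+ suc a) b≡ ⟨
  suc b + suc a                      ≡⟨ cong suc (+-comm b (suc a)) ⟩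
  1 + suc (a + b)                    ∎)
  where open ≡-Reasoning

-- The order of addable and removable boxes

infix 4 _[_]≺_

-- The strict reading order of the signature: by ladder, then top to bottom.
_[_]≺_ : Position → ℕ → Position → Set
p [ ℓ ]≺ q = ladderIndex ℓ p < ladderIndex ℓ q ⊎ (ladderIndex ℓ p ≡ ladderIndex ℓ q × proj₁ p < proj₁ q)

module _ {ℓ : ℕ} .{{_ : NonZero ℓ}} where

  -- The last value is at least ℓ, and each step upwards adds at least ℓ, because a multiple of ℓ
  -- that exceeds kℓ is at least (k + 1)ℓ.
  multiples-descent : ∀ k (f : ℕ → ℕ) → (∀ {j} → j < k → ℓ ∣ f j × 0 < f j) →
                      (∀ {j} → suc j < k → f (suc j) < f j) → k * ℓ ≤ f 0
  multiples-descent zero    f _  _ = z≤n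
  multiples-descent (suc k) f ok decr with proj₁ (ok z<s) | below k refl
    where
    below : ∀ k′ → k′ ≡ k → k′ * ℓ < f 0
    below zero     refl = proj₂ (ok z<s)
    below (suc k′) refl = ≤-<-trans (multiples-descent k (f ∘ suc) (ok ∘ s<s) (decr ∘ s<s)) (decr (s<s z<s))
  ... | divides q f≡ | kℓ<f = subst (suc k * ℓ ≤_) (sym f≡) (*-monoˡ-≤ ℓ (*-cancelʳ-< ℓ k q (subst (k * ℓ <_) f≡ kℓ<f)))

  -- The equation says that `h` is the content of `(c , d)` minus that of `(a , b)`. Shifted by
  -- `a * ℓ`, the two contents become the naturals `z + h` and `z`.
  residue-≡⇒∣ : ∀ a b c d {h} → residue ℓ (a , b) ≡ residue ℓ (c , d) → h + (c + b) ≡ d + a → ℓ ∣ h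
  residue-≡⇒∣ a b c d {h} same h≡ = %≡⇒∣ ℓ z (begin
    (z + h) % ℓ        ≡⟨ residue-shift ℓ a c d shifted ⟨
    residue ℓ (c , d)  ≡⟨ same ⟨
    residue ℓ (a , b)  ≡⟨ residue-shift ℓ a a b z+a≡ ⟩
    z % ℓ              ∎)
    where
    open ≡-Reasoning
    z    = proj₁ (diagonal ℓ a b)
    z+a≡ = proj₂ (diagonal ℓ a b)
    regroup₁ : ∀ z h c a → (z + h + c) + a ≡ (z + a) + (h + c)
    regroup₁ = solve-∀
    regroup₂ : ∀ b M h c → (b + M) + (h + c) ≡ (h + (c + b)) + M
    regroup₂ = solve-∀
    regroup₃ : ∀ d a M → (d + a) + M ≡ (d + M) + a
    regroup₃ = solve-∀
    shifted : z + h + c ≡ d + a * ℓ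
    shifted = +-cancelʳ-≡ a _ _ (begin
      (z + h + c) + a        ≡⟨ regroup₁ z h c a ⟩
      (z + a) + (h + c)      ≡⟨ cong (_+ (h + c)) z+a≡ ⟩
      (b + a * ℓ) + (h + c)  ≡⟨ regroup₂ b (a * ℓ) h c ⟩
      (h + (c + b)) + a * ℓ  ≡⟨ cong (_+ a * ℓ) h≡ ⟩
      (d + a) + a * ℓ        ≡⟨ regroup₃ d a (a * ℓ) ⟩
      (d + a * ℓ) + a        ∎)

module _ {L : ℕ} (2≤L : 2 ≤ L) (μ : Partition) (jm : IsJM (suc L) μ) where

  private
    ℓ = suc L

    ℓ∤1 : ℓ ∤ 1
    ℓ∤1 ℓ∣1 = <⇒≱ (≤-trans (s≤s (≤-trans (s≤s z≤n) 2≤L)) (∣⇒≤ ℓ∣1)) ≤-refl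

  addable≺removable : ∀ {p q} → residue ℓ p ≡ residue ℓ q → OuterCorner μ p → InnerCorner μ q → p [ ℓ ]≺ q
  addable≺removable {a , b} {c , d} same outer inner with c <? a
  -- The removable box is the upper one, so the corner is `(c , b)` and the `k` boxes of column `b`
  -- from row `c` down to row a - 1 carry multiples of ℓ.
  ... | yes c<a = inj₁ (begin-strict
      a + L * b               ≡⟨ cong (_+ L * b) a≡ ⟨
      c + k + L * b           <⟨ +-monoˡ-< (L * b) (+-monoʳ-< c k<) ⟩
      c + L * (k * L) + L * b ≡⟨ factor c L (k * L) b ⟩
      c + L * (k * L + b)     ≤⟨ +-monoʳ-≤ c (*-monoʳ-≤ L kL+b≤d) ⟩
      c + L * d               ∎)
    where
    open ≤-Reasoning
    up = outerCorner⇒upIn μ a outer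
    b≡ = outerCorner⇒≡ μ a outer
    k  = a ∸ c
    a≡ : c + k ≡ a
    a≡ = m+[n∸m]≡n (<⇒≤ c<a)
    h  = hookLength μ (c , b)
    tall : Height μ b a
    tall = up , ≤-reflexive (sym b≡)
    b<row : ∀ {x} → x < a → b < row μ x
    b<row = upIn-above μ up
    h≡ : h + (c + b) ≡ d + a
    h≡ = suc-injective (trans (sym (+-suc h (c + b)))
           (trans (hookLength-height μ tall (b<row c<a)) (cong (_+ a) (sym (proj₁ inner)))))
    -- Otherwise `(c , b)`, the removable box with hook length 1, and `(x , b)` would violate the JM
    -- condition.
    column : ∀ {x} → x < a → ℓ ∣ hookLength μ (x , b)
    column {x} x<a with ℓ ∣? hookLength μ (x , b)
    ... | yes ℓ∣h = ℓ∣h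
    ... | no  ℓ∤h = contradiction
      ( b<row c<a , ≤-reflexive (proj₁ inner) , b<row x<a , residue-≡⇒∣ a b c d same h≡
      , subst (ℓ ∤_) (sym (innerCorner⇒hookLength μ inner)) ℓ∤1 , ℓ∤h)
      (jm c b x d)
    inside : ∀ {j} → j < k → c + j < a
    inside {j} j<k = subst (c + j <_) a≡ (+-monoʳ-< c j<k)
    kℓ≤h : k * ℓ ≤ h
    kℓ≤h = subst (λ x → k * ℓ ≤ hookLength μ (x , b)) (+-identityʳ c)
      (multiples-descent k (λ j → hookLength μ (c + j , b))
      (λ j<k → column (inside j<k) , hookLength-positive μ tall (b<row (inside j<k)))
      (λ {j} j<k → subst (λ x → hookLength μ (x , b) < hookLength μ (c + j , b)) (sym (+-suc c j))
        (hookLength-down μ tall (b<row (subst (_< a) (+-suc c j) (inside j<k))))))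
    expand : ∀ c k L b → (k * L + b) + (c + k) ≡ k * suc L + (c + b)
    expand = solve-∀
    kL+b≤d : k * L + b ≤ d
    kL+b≤d = +-cancelʳ-≤ a _ _ (begin
      k * L + b + a         ≡⟨ cong (k * L + b +_) a≡ ⟨
      k * L + b + (c + k)   ≡⟨ expand c k L b ⟩
      k * ℓ + (c + b)       ≤⟨ +-monoˡ-≤ (c + b) kℓ≤h ⟩
      h + (c + b)           ≡⟨ h≡ ⟩
      d + a                 ∎)
    -- Strictness comes from `2 ≤ L`; at L = 1 both sides would be equal.
    k< : k < L * (k * L)
    k< = begin-strict
      k            ≡⟨ *-identityʳ k ⟨
      k * 1        <⟨ *-monoʳ-< k {{>-nonZero (m<n⇒0<n∸m c<a)}} 2≤L ⟩
      k * L        ≤⟨ m≤n*m (k * L) L {{>-nonZero (≤-trans (s≤s z≤n) 2≤L)}} ⟩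
      L * (k * L)  ∎
    factor : ∀ c L t b → c + L * t + L * b ≡ c + L * (t + b)
    factor = solve-∀
  -- Now the corner is `(a , d)`, and the multiples of ℓ lie along row `a`. The bound on ladders is
  -- only weak, but on a common ladder the addable box is higher and is read first.
  ... | no c≮a = case m≤n⇒m<n∨m≡n index≤ of λ { (inj₁ <) → inj₁ < ; (inj₂ ≡) → inj₂ (≡ , a<c) }
    where
    open ≤-Reasoning
    a≤c = ≮⇒≥ c≮a
    b≡ = outerCorner⇒≡ μ a outer
    d<b : d < b
    d<b = subst (d <_) (sym b≡) (≤-trans (≤-reflexive (proj₁ inner)) (row-anti μ a≤c))
    k  = b ∸ d
    b≡′ : d + k ≡ b
    b≡′ = m+[n∸m]≡n (<⇒≤ d<b)
    h  = hookLength μ (a , d)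
    tall : Height μ d (suc c)
    tall = innerCorner⇒height μ inner
    <row : ∀ {y} → y < b → y < row μ a
    <row {y} = subst (y <_) b≡
    h≡ : h + (a + d) ≡ b + c
    h≡ = suc-injective (trans (sym (+-suc h (a + d)))
           (trans (hookLength-height μ tall (<row d<b)) (trans (cong (_+ suc c) (sym b≡)) (+-suc b c))))
    along : ∀ {y} → y < b → ℓ ∣ hookLength μ (a , y)
    along {y} y<b with ℓ ∣? hookLength μ (a , y)
    ... | yes ℓ∣h = ℓ∣h
    ... | no  ℓ∤h = contradiction
      ( <row d<b , <row y<b , ≤-reflexive (proj₁ inner) , residue-≡⇒∣ c d a b (sym same) h≡
      , ℓ∤h , subst (ℓ ∤_) (sym (innerCorner⇒hookLength μ inner)) ℓ∤1)
      (jm a d c y)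
    inside : ∀ {j} → j < k → d + j < b
    inside {j} j<k = subst (d + j <_) b≡′ (+-monoʳ-< d j<k)
    kℓ≤h : k * ℓ ≤ h
    kℓ≤h = subst (λ y → k * ℓ ≤ hookLength μ (a , y)) (+-identityʳ d)
      (multiples-descent k (λ j → hookLength μ (a , d + j))
      (λ {j} j<k → along (inside j<k) , hookLength-positive μ (proj₂ (height μ (d + j))) (<row (inside j<k)))
      (λ {j} j<k → subst (λ y → hookLength μ (a , y) < hookLength μ (a , d + j)) (sym (+-suc d j))
        (hookLength-right μ (<row (subst (_< b) (+-suc d j) (inside j<k))))))
    expand : ∀ a d k L → (a + L * k) + (d + k) ≡ k * suc L + (a + d)
    expand = solve-∀
    a+Lk≤c : a + L * k ≤ c
    a+Lk≤c = +-cancelʳ-≤ b _ _ (begin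
      a + L * k + b        ≡⟨ cong (a + L * k +_) b≡′ ⟨
      a + L * k + (d + k)  ≡⟨ expand a d k L ⟩
      k * ℓ + (a + d)      ≤⟨ +-monoˡ-≤ (a + d) kℓ≤h ⟩
      h + (a + d)          ≡⟨ h≡ ⟩
      b + c                ≡⟨ +-comm b c ⟩
      c + b                ∎)
    factor : ∀ a L k d → a + L * (d + k) ≡ a + L * k + L * d
    factor = solve-∀
    index≤ : a + L * b ≤ c + L * d
    index≤ = begin
      a + L * b          ≡⟨ cong (λ n → a + L * n) b≡′ ⟨
      a + L * (d + k)    ≡⟨ factor a L k d ⟩
      a + L * k + L * d  ≤⟨ +-monoˡ-≤ (L * d) a+Lk≤c ⟩
      c + L * d          ∎
    a<c : a < c
    a<c = <-≤-trans (m<m+n a (*-mono-≤ (≤-trans (s≤s z≤n) 2≤L) (m<n⇒0<n∸m d<b))) a+Lk≤c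

-- The Maya diagram of a partition

-- Positions are contents shifted by M: a row gives the content of its last box (of the position
-- left of column 0 if it is empty), a column that of the first position below it.

Bead : ℕ → Partition → ℕ → Set
Bead M μ z = ∃[ a ] z + suc a ≡ row μ a + M

Gap : ℕ → Partition → ℕ → Set
Gap M μ z = ∃[ a ] ∃[ b ] Height μ b a × z + a ≡ b + M

module _ {M : ℕ} (μ : Partition) {a b c g β : ℕ} (h : Height μ b c)
         (β≡ : β + suc a ≡ row μ a + M) (g≡ : g + c ≡ b + M) where

  hook-distance : b < row μ a → g + hookLength μ (a , b) ≡ β
  hook-distance b<row = +-cancelʳ-≡ (c + suc (a + b)) _ _ (begin
    g + H + (c + suc (a + b))    ≡⟨ regroup₁ g H c (suc (a + b)) ⟩
    (g + c) + (H + suc (a + b))  ≡⟨ cong₂ _+_ g≡ (hookLength-height μ h b<row) ⟩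
    (b + M) + (row μ a + c)      ≡⟨ regroup₂ b M (row μ a) c ⟩
    (row μ a + M) + (b + c)      ≡⟨ cong (_+ (b + c)) β≡ ⟨
    (β + suc a) + (b + c)        ≡⟨ regroup₃ β a b c ⟩
    β + (c + suc (a + b))        ∎)
    where
    open ≡-Reasoning
    H = hookLength μ (a , b)
    regroup₁ : ∀ g H c t → g + H + (c + t) ≡ (g + c) + (H + t)
    regroup₁ = solve-∀
    regroup₂ : ∀ b M r c → (b + M) + (r + c) ≡ (r + M) + (b + c)
    regroup₂ = solve-∀
    regroup₃ : ∀ β a b c → (β + suc a) + (b + c) ≡ β + (c + suc (a + b))
    regroup₃ = solve-∀

  box⇒gap<bead : b < row μ a → g < β
  box⇒gap<bead b<row = subst (g <_) (hook-distance b<row) (m<m+n g (hookLength-positive μ h b<row))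

  -- If row `a` stops before column `b`, that column ends above row `a`, so `c ≤ a`; both facts push
  -- the gap past the bead.
  noBox⇒bead<gap : row μ a ≤ b → β < g
  noBox⇒bead<gap row≤b = +-cancelʳ-≤ a _ _ (begin
    suc β + a    ≡⟨ +-suc β a ⟨
    β + suc a    ≡⟨ β≡ ⟩
    row μ a + M  ≤⟨ +-monoˡ-≤ M row≤b ⟩
    b + M        ≡⟨ g≡ ⟨
    g + c        ≤⟨ +-monoʳ-≤ g (≮⇒≥ λ a<c → <⇒≱ (upIn-above μ (proj₁ h) a<c) row≤b) ⟩
    g + a        ∎)
    where open ≤-Reasoning

  gap<bead⇒box : g < β → b < row μ a
  gap<bead⇒box g<β = ≰⇒> λ row≤b → <-asym g<β (noBox⇒bead<gap row≤b)

-- Whether or not the row and the column meet in a box, their positions are strictly ordered.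
bead-gap-disjoint : ∀ {M} μ {z} → Bead M μ z → ¬ Gap M μ z
bead-gap-disjoint μ (a , β≡) (c , b , h , g≡) with b <? row μ a
... | yes b<row = <-irrefl refl (box⇒gap<bead μ h β≡ g≡ b<row)
... | no  b≮row = <-irrefl refl (noBox⇒bead<gap μ h β≡ g≡ (≮⇒≥ b≮row))

module _ {ℓ : ℕ} .{{_ : NonZero ℓ}} {M : ℕ} (μ : Partition) where

  IsJM⇒JMaya : IsJM ℓ μ → JMaya ℓ (Bead M μ) (Gap M μ)
  IsJM⇒JMaya jm {g} {β} {g′} {β′} (c , b , h , g≡) (a , β≡) (c′ , y , h′ , g′≡) (x , β′≡) g<β g′<β g<β′ same ≢₁ ≢₂ =
    jm a b x y (ab , ay , xb
      , %≡⇒∣ ℓ g (trans (cong (_% ℓ) (hook-distance μ h β≡ g≡ ab)) (sym same))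
      , (λ ℓ∣ → ≢₁ (trans (sym (∣⇒%≡ ℓ g′ ℓ∣)) (cong (_% ℓ) (hook-distance μ h′ β≡ g′≡ ay))))
      , (λ ℓ∣ → ≢₂ (trans (cong (_% ℓ) (sym (hook-distance μ h β′≡ g≡ xb))) (∣⇒%≡ ℓ g ℓ∣))))
    where
    ab = gap<bead⇒box μ h β≡ g≡ g<β
    ay = gap<bead⇒box μ h′ β≡ g′≡ g′<β
    xb = gap<bead⇒box μ h β′≡ g≡ g<β′

  -- The bound on `M` makes the positions of all nonempty rows and of all columns nonnegative, so
  -- the truncated subtractions below are exact.
  JMaya⇒IsJM : bound μ ≤ M → JMaya ℓ (Bead M μ) (Gap M μ) → IsJM ℓ μ
  JMaya⇒IsJM bound≤M J a b x y (ab , ay , xb , ℓ∣ , ℓ∤₁ , ℓ∤₂) =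
    let β  , β≡  = bead ab
        β′ , β′≡ = bead xb
        g  , c  , h  , g≡  = gap b
        g′ , c′ , h′ , g′≡ = gap y
        ab≡ = hook-distance μ h β≡ g≡ ab
        ay≡ = hook-distance μ h′ β≡ g′≡ ay
        xb≡ = hook-distance μ h β′≡ g≡ xb
    in J (c , b , h , g≡) (a , β≡) (c′ , y , h′ , g′≡) (x , β′≡)
         (box⇒gap<bead μ h β≡ g≡ ab) (box⇒gap<bead μ h′ β≡ g′≡ ay) (box⇒gap<bead μ h β′≡ g≡ xb)
         (trans (sym (∣⇒%≡ ℓ g ℓ∣)) (cong (_% ℓ) ab≡))
         (λ e → ℓ∤₁ (%≡⇒∣ ℓ g′ (trans (cong (_% ℓ) ay≡) (sym e))))
         (λ e → ℓ∤₂ (%≡⇒∣ ℓ g (trans (cong (_% ℓ) xb≡) e)))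
    where
    bead : ∀ {a b} → b < row μ a → ∃[ β ] β + suc a ≡ row μ a + M
    bead {a} b<row = row μ a + M ∸ suc a , m∸n+n≡m (≤-trans (≤-trans a<bound bound≤M) (m≤n+m M (row μ a)))
      where
      a<bound : a < bound μ
      a<bound = ≰⇒> λ bound≤a → n≮0 (<-≤-trans b<row (≤-trans (row-anti μ bound≤a) (≤-reflexive (row-bound μ))))
    gap : ∀ b → ∃[ g ] ∃[ c ] Height μ b c × g + c ≡ b + M
    gap b with height μ b
    ... | c , h = b + M ∸ c , c , h , m∸n+n≡m (≤-trans (≤-trans (height≤bound μ h) bound≤M) (m≤n+m M b))

upIn-≤ : ∀ μ a {b b′} → b ≤ b′ → UpIn μ a b′ → UpIn μ a b
upIn-≤ μ zero    _    _  = tt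
upIn-≤ μ (suc a) b≤b′ up = ≤-<-trans b≤b′ up

upIn? : ∀ μ a b → Dec (UpIn μ a b)
upIn? μ zero    b = yes tt
upIn? μ (suc a) b = b <? row μ a

row-mono : ∀ {μ ν} → (∀ q → q ∈ μ → q ∈ ν) → ∀ a → row μ a ≤ row ν a
row-mono {μ} {ν} μ⊆ν a = ≮⇒≥ λ lt → <-irrefl refl (μ⊆ν (a , row ν a) lt)

upIn-mono : ∀ {μ ν} → (∀ q → q ∈ μ → q ∈ ν) → ∀ a {b} → UpIn μ a b → UpIn ν a b
upIn-mono μ⊆ν zero    _  = tt
upIn-mono μ⊆ν (suc a) up = μ⊆ν _ up

-- Adding or removing all boxes of one residue, on the Maya diagram

module _ (ℓ : ℕ) .{{_ : NonZero ℓ}} (i : ℕ) where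

  AddableI RemovableI : Partition → Position → Set
  AddableI   μ q = residue ℓ q ≡ i × OuterCorner μ q
  RemovableI μ q = residue ℓ q ≡ i × InnerCorner μ q

  Filled Emptied : Partition → Partition → Set
  Filled  μ ν = ∀ q → q ∈ ν ⇔ (q ∈ μ ⊎ AddableI μ q)
  Emptied μ ν = ∀ q → q ∈ ν ⇔ (q ∈ μ × ¬ RemovableI μ q)

  module _ {m : ℕ} {μ ν : Partition} where

    private
      -- A shift by a multiple of ℓ lets positions modulo ℓ be read as residues.
      M = m * ℓ

      residue-at : ∀ a b {z} → z + a ≡ b + M → residue ℓ (a , b) ≡ z % ℓ
      residue-at = residue-shift ℓ m

      moveˡ : ∀ z a {n} → z + suc a ≡ n → suc z + a ≡ n
      moveˡ z a = trans (sym (+-suc z a))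

      moveʳ : ∀ z a {n} → suc z + a ≡ n → z + suc a ≡ n
      moveʳ z a = trans (+-suc z a)

    module _ (filled : Filled μ ν) where
      private
        row≤ : ∀ a → row μ a ≤ row ν a
        row≤ = row-mono {μ} {ν} λ q → from (filled q) ∘ inj₁

      -- Either the row grew and its bead came from `z`, or it stayed. If it stayed although the
      -- position after its end has residue `i`, it is blocked by an equally long row above, whose
      -- bead is one higher.
      filled-bead : ∀ {z} → Bead M ν (suc z) →
        (suc z % ℓ ≡ i × Bead M μ z) ⊎
        (Bead M μ (suc z) × (suc (suc z) % ℓ ≡ i → Bead M μ (suc (suc z))))
      filled-bead {z} (a , z≡) with m≤n⇒m<n∨m≡n (row≤ a)
      ... | inj₂ same = inj₂ ((a , trans z≡ (cong (_+ M) (sym same))) , next a same z≡)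
        where
        next : ∀ a → row μ a ≡ row ν a → suc z + suc a ≡ row ν a + M → suc (suc z) % ℓ ≡ i → Bead M μ (suc (suc z))
        next a same z≡ z%≡i with upIn? μ a (row ν a)
        ... | yes up = contradiction
          (from (filled (a , row ν a))
            (inj₂ (trans (residue-at a (row ν a) (moveˡ (suc z) a z≡)) z%≡i , upIn⇒outerCorner μ a (sym same) up)))
          (<-irrefl refl)
        next zero    _ _ _ | no ¬up = contradiction tt ¬up
        next (suc a) same z≡ _ | no ¬up = a , trans (moveˡ (suc z) (suc a) z≡) (cong (_+ M)
          (≤-antisym (≤-trans (≤-reflexive (sym same)) (row-suc μ a)) (≮⇒≥ ¬up)))
      ... | inj₁ row< with row ν a in row≡
      ...   | suc b with to (filled (a , b)) (≤-reflexive (sym row≡))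
      ...     | inj₁ b<row = contradiction row< (<⇒≱ (s≤s b<row))
      ...     | inj₂ (residue≡i , outer) = inj₁
        ( trans (sym (residue-at a b (suc-injective (trans (sym (+-suc (suc z) a)) z≡)))) residue≡i
        , a , trans (suc-injective z≡) (cong (_+ M) (outerCorner⇒≡ μ a outer)))

      -- A column that grew moved its gap down by one. One that stayed although the position below
      -- it has residue `i` is blocked by the column to its left having the same height, whose gap
      -- is one lower.
      filled-gap : bound μ ≤ M → ∀ {z} → Gap M ν z →
        (suc z % ℓ ≡ i × Gap M μ (suc z)) ⊎
        (Gap M μ z × (z % ℓ ≡ i → ∃[ z′ ] z ≡ suc z′ × Gap M μ z′))
      filled-gap bound≤M (a , b , (upν , rowν≤b) , z≡) with upIn? μ a b
      filled-gap bound≤M {z} (a , b , (upν , rowν≤b) , z≡) | yes up =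
        inj₂ ((a , b , (up , rowμ≤b) , z≡) , λ z%≡i → next z b up rowν≤b z≡ (trans (residue-at a b z≡) z%≡i))
        where
        rowμ≤b = ≤-trans (row≤ a) rowν≤b
        next : ∀ z b → UpIn μ a b → row ν a ≤ b → z + a ≡ b + M → residue ℓ (a , b) ≡ i →
               ∃[ z′ ] z ≡ suc z′ × Gap M μ z′
        next z b up rowν≤b z≡ residue≡i with m≤n⇒m<n∨m≡n (≤-trans (row≤ a) rowν≤b)
        ... | inj₂ same = contradiction
          (<-≤-trans (from (filled (a , b)) (inj₂ (residue≡i , upIn⇒outerCorner μ a (sym same) up))) rowν≤b)
          (<-irrefl refl)
        next (suc z) (suc b) up _ z≡ _ | inj₁ (s≤s row≤b) =
          z , refl , a , b , (upIn-≤ μ a (n≤1+n b) up , row≤b) , suc-injective z≡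
        -- A column other than column 0 with gap at 0 would have height above `M`, contrary to
        -- `bound μ ≤ M`.
        next zero (suc b) up _ z≡ _ | inj₁ (s≤s row≤b) = contradiction
          (≤-trans (height≤bound μ (up , m≤n⇒m≤1+n row≤b)) bound≤M)
          (<⇒≱ (subst (M <_) (sym z≡) (s≤s (m≤n+m M b))))
      filled-gap bound≤M (zero  , b , (upν , rowν≤b) , z≡) | no ¬up = contradiction tt ¬up
      filled-gap bound≤M {z} (suc a , b , (upν , rowν≤b) , z≡) | no ¬up with to (filled (a , b)) upν
      ... | inj₁ up = contradiction up ¬up
      ... | inj₂ (residue≡i , outer) = inj₁
        ( trans (sym (residue-at a b (moveˡ z a z≡))) residue≡i
        , a , b , (outerCorner⇒upIn μ a outer , ≮⇒≥ ¬up) , moveˡ z a z≡)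

    module _ (emptied : Emptied μ ν) where
      private
        ν⊆μ : ∀ q → q ∈ ν → q ∈ μ
        ν⊆μ q = proj₁ ∘ to (emptied q)

        row≥ : ∀ a → row ν a ≤ row μ a
        row≥ = row-mono {ν} {μ} ν⊆μ

        erased : ∀ {a b} → b < row μ a → row ν a ≤ b → RemovableI μ (a , b)
        erased {a} {b} b<row row≤b = decidable-stable (residue ℓ (a , b) ≟ i ×-dec innerCorner? μ (a , b))
          λ ¬rem → <⇒≱ (from (emptied (a , b)) (b<row , ¬rem)) row≤b

      -- A row that kept a last box of residue `i` is as long as the row below it, whose bead is one
      -- lower.
      emptied-bead : ∀ {z} → Bead M ν (suc z) →
        (suc (suc z) % ℓ ≡ i × Bead M μ (suc (suc z))) ⊎
        (Bead M μ (suc z) × (suc z % ℓ ≡ i → Bead M μ z))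
      emptied-bead {z} (a , z≡) with m≤n⇒m<n∨m≡n (row≥ a)
      ... | inj₁ row< = let residue≡i , suc≡ , _ = erased row< ≤-refl in inj₁
        ( trans (sym (residue-at a (row ν a) (moveˡ (suc z) a z≡))) residue≡i
        , a , trans (cong suc z≡) (cong (_+ M) suc≡))
      ... | inj₂ same = inj₂ ((a , trans z≡ (cong (_+ M) same)) , λ z%≡i →
        suc a , trans (moveʳ z (suc a) z≡) (cong (_+ M) (next (row ν a) refl z≡ z%≡i)))
        where
        next : ∀ b → b ≡ row ν a → suc z + suc a ≡ b + M → suc z % ℓ ≡ i → b ≡ row μ (suc a)
        -- An empty row has no last box, but the row below is empty too, so the lengths still agree.
        next zero    b≡ _  _    = sym (n≤0⇒n≡0 (≤-trans (row-suc μ a) (≤-reflexive (sym (trans b≡ same)))))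
        next (suc b) b≡ z≡ z%≡i = sym (≤-antisym
          (≤-trans (row-suc μ a) (≤-reflexive (sym (trans b≡ same))))
          (≰⇒> λ below → proj₂ (to (emptied (a , b)) (≤-reflexive b≡))
            ( trans (residue-at a b (suc-injective (trans (sym (+-suc (suc z) a)) z≡))) z%≡i
            , trans b≡ same , below)))

      -- A column that kept a lowest box of residue `i` has a neighbour to the right of the same
      -- height, whose gap is one higher; next to an empty column the neighbour is empty as well.
      emptied-gap : bound μ ≤ M → ∀ {z} → Gap M ν z →
        (z % ℓ ≡ i × ∃[ z′ ] z ≡ suc z′ × Gap M μ z′) ⊎
        (Gap M μ z × (suc z % ℓ ≡ i → Gap M μ (suc z)))
      emptied-gap bound≤M {z} (a , b , (up , row≤b) , z≡) with b <? row μ a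
      ... | yes b<row = let residue≡i , inner = erased b<row row≤b in
        inj₁ (trans (sym (residue-at a b z≡)) residue≡i , previous z (innerCorner⇒height μ inner) z≡)
        where
        previous : ∀ z → Height μ b (suc a) → z + a ≡ b + M → ∃[ z′ ] z ≡ suc z′ × Gap M μ z′
        previous zero    h z≡ = contradiction (≤-trans (height≤bound μ h) bound≤M)
                                              (≤⇒≯ (≤-trans (m≤n+m M b) (≤-reflexive (sym z≡))))
        previous (suc z) h z≡ = z , refl , suc a , b , h , moveʳ z a z≡
      ... | no b≮row = inj₂ ((a , b , (upIn-mono {ν} {μ} ν⊆μ a up , ≮⇒≥ b≮row) , z≡) , λ z%≡i →
        a , suc b , (right a up (≮⇒≥ b≮row) z≡ z%≡i , m≤n⇒m≤1+n (≮⇒≥ b≮row)) , cong suc z≡)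
        where
        right : ∀ a → UpIn ν a b → row μ a ≤ b → z + a ≡ b + M → suc z % ℓ ≡ i → UpIn μ a (suc b)
        right zero    _  _     _  _    = tt
        right (suc a) up row≤b z≡ z%≡i = ≤∧≢⇒< (ν⊆μ _ up) λ suc≡ →
          proj₂ (to (emptied (a , b)) up) (trans (residue-at a b (moveˡ z a z≡)) z%≡i , suc≡ , row≤b)

  module _ (2≤ℓ : 2 ≤ ℓ) (i<ℓ : i < ℓ) {μ ν : Partition} (jm : IsJM ℓ μ) where

    private
      -- Large enough for one shift to serve both Maya diagrams.
      m = bound μ + bound ν
      M = m * ℓ

      bound≤ : ∀ {n} → n ≤ m → n ≤ M
      bound≤ n≤m = ≤-trans n≤m (m≤m*n m ℓ)

      boundμ≤M : bound μ ≤ M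
      boundμ≤M = bound≤ (m≤m+n (bound μ) (bound ν))

      -- The class i - 1, from which adding a box of residue `i` moves a bead to class `i`.
      j = (i + pred ℓ) % ℓ

      suc-j : ∀ {z} → z % ℓ ≡ j → suc z % ℓ ≡ i
      suc-j {z} z%≡j = begin
        suc z % ℓ             ≡⟨ %-congʳ-+ ℓ 1 {z} {i + pred ℓ} z%≡j ⟩
        suc (i + pred ℓ) % ℓ  ≡⟨ cong (_% ℓ) (trans (sym (+-suc i (pred ℓ))) (cong (i +_) (suc-pred ℓ))) ⟩
        (i + ℓ) % ℓ           ≡⟨ [m+n]%n≡m%n i ℓ ⟩
        i % ℓ                 ≡⟨ m<n⇒m%n≡m i<ℓ ⟩
        i                     ∎
        where
        open ≡-Reasoning

      pred-i : ∀ {z} → suc z % ℓ ≡ i → z % ℓ ≡ j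
      pred-i {z} eq = suc-%-injective ℓ (trans eq (sym (suc-j {i + pred ℓ} refl)))

      j≢i : j ≢ i
      j≢i j≡i = suc-%-≢ ℓ 2≤ℓ j (trans (suc-j j%≡j) (sym (trans j%≡j j≡i)))
        where j%≡j = m%n%n≡m%n (i + pred ℓ) ℓ

      from-toggle : ∀ {r s} → Toggle ℓ r s (Bead M μ) (Gap M μ) (Bead M ν) (Gap M ν) → IsJM ℓ ν
      from-toggle T = JMaya⇒IsJM ν (bound≤ (m≤n+m (bound ν) (bound μ)))
                                  (toggle-JMaya ℓ T (IsJM⇒JMaya μ jm))

    -- Beads move up from class `j` to class `i`, so `i` is the class that is filled first.
    filled-IsJM : Filled μ ν → IsJM ℓ ν
    filled-IsJM filled = from-toggle {j} {i} record
      { r≢s      = j≢i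
      ; disjoint = bead-gap-disjoint μ
      ; bead-off = λ { {suc z} _ _ ≢i B → case filled-bead {m} {μ} {ν} filled B of λ
          { (inj₁ (≡i , _)) → contradiction ≡i ≢i ; (inj₂ (B , _)) → B } }
      ; gap-off  = λ ≢j _ G → case filled-gap {m} {μ} {ν} filled boundμ≤M G of λ
          { (inj₁ (≡i , _)) → contradiction (pred-i ≡i) ≢j ; (inj₂ (G , _)) → G }
      ; bead-r   = λ { {suc z} _ ≡j B → case filled-bead {m} {μ} {ν} filled B of λ
          { (inj₁ (≡i , _)) → contradiction (trans (sym ≡j) ≡i) j≢i
          ; (inj₂ (B , B⁺)) → B , _ , inj₂ refl , suc-j ≡j , B⁺ (suc-j ≡j) } }
      ; gap-r    = λ ≡j G → case filled-gap {m} {μ} {ν} filled boundμ≤M G of λ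
          { (inj₁ (≡i , G)) → inj₂ (_ , inj₂ refl , ≡i , G) ; (inj₂ (G , _)) → inj₁ G }
      ; bead-s   = λ { {suc z} _ ≡i B → case filled-bead {m} {μ} {ν} filled B of λ
          { (inj₁ (_ , B)) → inj₂ (_ , inj₁ refl , pred-i ≡i , B) ; (inj₂ (B , _)) → inj₁ B } }
      ; gap-s    = λ ≡i G → case filled-gap {m} {μ} {ν} filled boundμ≤M G of λ
          { (inj₁ (suc≡i , _)) → contradiction (trans (sym (pred-i suc≡i)) ≡i) j≢i
          ; (inj₂ (G , G⁻)) → case G⁻ ≡i of λ { (_ , refl , G⁻) → G , _ , inj₁ refl , pred-i ≡i , G⁻ } }
      }

    -- Beads move down from class `i` to class `j`, so the two classes exchange roles.
    emptied-IsJM : Emptied μ ν → IsJM ℓ ν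
    emptied-IsJM emptied = from-toggle {i} {j} record
      { r≢s      = j≢i ∘ sym
      ; disjoint = bead-gap-disjoint μ
      ; bead-off = λ { {suc z} _ _ ≢j B → case emptied-bead {m} {μ} {ν} emptied B of λ
          { (inj₁ (≡i , _)) → contradiction (pred-i ≡i) ≢j ; (inj₂ (B , _)) → B } }
      ; gap-off  = λ ≢i _ G → case emptied-gap {m} {μ} {ν} emptied boundμ≤M G of λ
          { (inj₁ (≡i , _)) → contradiction ≡i ≢i ; (inj₂ (G , _)) → G }
      ; bead-r   = λ { {suc z} _ ≡i B → case emptied-bead {m} {μ} {ν} emptied B of λ
          { (inj₁ (suc≡i , _)) → contradiction (trans (sym (pred-i suc≡i)) ≡i) j≢i
          ; (inj₂ (B , B⁻)) → B , _ , inj₁ refl , pred-i ≡i , B⁻ ≡i } }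
      ; gap-r    = λ ≡i G → case emptied-gap {m} {μ} {ν} emptied boundμ≤M G of λ
          { (inj₁ (_ , _ , refl , G)) → inj₂ (_ , inj₁ refl , pred-i ≡i , G) ; (inj₂ (G , _)) → inj₁ G }
      ; bead-s   = λ { {suc z} _ ≡j B → case emptied-bead {m} {μ} {ν} emptied B of λ
          { (inj₁ (≡i , B)) → inj₂ (_ , inj₂ refl , ≡i , B) ; (inj₂ (B , _)) → inj₁ B } }
      ; gap-s    = λ ≡j G → case emptied-gap {m} {μ} {ν} emptied boundμ≤M G of λ
          { (inj₁ (≡i , _)) → contradiction (trans (sym ≡j) ≡i) j≢i
          ; (inj₂ (G , G⁺)) → G , _ , inj₂ refl , suc-j ≡j , G⁺ (suc-j ≡j) }
      }

-- Signatures

module _ {A : Set} {_≺_ : A → A → Set} (≺-asym : ∀ {x y} → x ≺ y → ¬ (y ≺ x)) where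

  -- If the heads differed, each would precede the other. This identifies the list of addable or
  -- removable boxes after one step with the old list less one end.
  sorted-unique : ∀ {xs ys} → AllPairs _≺_ xs → AllPairs _≺_ ys →
                  (∀ {z} → z ∈ˡ xs → z ∈ˡ ys) → (∀ {z} → z ∈ˡ ys → z ∈ˡ xs) → xs ≡ ys
  sorted-unique []         []         _  _  = refl
  sorted-unique []         (_ ∷ _)    _  ys⊆ = contradiction (ys⊆ (here refl)) λ ()
  sorted-unique (_ ∷ _)    []         xs⊆ _  = contradiction (xs⊆ (here refl)) λ ()
  sorted-unique {x ∷ xs} {y ∷ ys} (x≺ ∷ xs≺) (y≺ ∷ ys≺) xs⊆ ys⊆ with same-head (xs⊆ (here refl)) (ys⊆ (here refl))
    where
    same-head : x ∈ˡ y ∷ ys → y ∈ˡ x ∷ xs → x ≡ y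
    same-head (here x≡y) _          = x≡y
    same-head (there _)  (here y≡x) = sym y≡x
    same-head (there x∈) (there y∈) = contradiction (All.lookup x≺ y∈) (≺-asym (All.lookup y≺ x∈))
  ... | refl = cong (x ∷_) (sorted-unique xs≺ ys≺ (strip x≺ xs⊆) (strip y≺ ys⊆))
    where
    strip : ∀ {us vs} → All (x ≺_) us → (∀ {z} → z ∈ˡ x ∷ us → z ∈ˡ x ∷ vs) → ∀ {z} → z ∈ˡ us → z ∈ˡ vs
    strip x≺ us⊆ z∈ with us⊆ (there z∈)
    ... | there z∈′ = z∈′
    ... | here refl = contradiction (All.lookup x≺ z∈) (≺-asym (All.lookup x≺ z∈))

last-∷ʳ : ∀ {A : Set} (xs : List A) x → last (xs ∷ʳ x) ≡ just x
last-∷ʳ []           x = refl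
last-∷ʳ (_ ∷ [])     x = refl
last-∷ʳ (_ ∷ y ∷ xs) x = last-∷ʳ (y ∷ xs) x

AllPairs-∷ʳ⁻ : ∀ {A : Set} {R : A → A → Set} xs {x} → AllPairs R (xs ∷ʳ x) → AllPairs R xs × All (λ y → R y x) xs
AllPairs-∷ʳ⁻ []       _          = [] , []
AllPairs-∷ʳ⁻ (y ∷ xs) (Ry ∷ Rxs) = let Rxs′ , Rx = AllPairs-∷ʳ⁻ xs Rxs
                                       Ry′ , Ryx = All.++⁻ xs Ry
                                   in Ry′ ∷ Rxs′ , All.head Ryx ∷ Rx

≺-asym : ∀ ℓ {p q} → p [ ℓ ]≺ q → ¬ (q [ ℓ ]≺ p)
≺-asym ℓ (inj₁ p<q)       (inj₁ q<p)       = <-asym p<q q<p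
≺-asym ℓ (inj₁ p<q)       (inj₂ (q≡p , _)) = <-irrefl (sym q≡p) p<q
≺-asym ℓ (inj₂ (p≡q , _)) (inj₁ q<p)       = <-irrefl (sym p≡q) q<p
≺-asym ℓ (inj₂ (_ , p<q)) (inj₂ (_ , q<p)) = <-asym p<q q<p

Lex : Position → Position → Set
Lex (a , b) (c , d) = a < c ⊎ (a ≡ c × b < d)

upTo-sorted : ∀ n → AllPairs _<_ (upTo n)
upTo-sorted n = AllPairs.applyUpTo⁺₁ id n λ i<j _ → i<j

cartesianProduct-sorted : ∀ {xs ys} → AllPairs _<_ xs → AllPairs _<_ ys → AllPairs Lex (cartesianProduct xs ys)
cartesianProduct-sorted []                        _   = []
cartesianProduct-sorted {x ∷ xs} {ys} (x< ∷ xs<) ys< = AllPairs.++⁺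
  (AllPairs.map⁺ (AllPairs.map (λ y<y′ → inj₂ (refl , y<y′)) ys<))
  (cartesianProduct-sorted xs< ys<)
  (All.map⁺ (All.tabulate λ _ → All.tabulate λ q∈ → inj₁ (All.lookup x< (proj₁ (∈-cartesianProduct⁻ xs ys q∈)))))

module _ {L : ℕ} (1≤L : 1 ≤ L) where

  private ℓ = suc L

  -- Along one ladder, listing row by row is reading top to bottom; within one row the ladder index
  -- already increases with the column.
  lex⇒≺ : ∀ {n ps} → AllPairs Lex ps → All (λ p → ladderIndex ℓ p ≡ n) ps → AllPairs _[ ℓ ]≺_ ps
  lex⇒≺ []           []             = []
  lex⇒≺ {n} (p< ∷ ps<) (p≡ ∷ ps≡) = All.zipWith step (p< , ps≡) ∷ lex⇒≺ ps< ps≡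
    where
    step : ∀ {q} → Lex _ q × ladderIndex ℓ q ≡ n → _ [ ℓ ]≺ q
    step (inj₁ a<c , q≡)          = inj₂ (trans p≡ (sym q≡) , a<c)
    step {c , d} (inj₂ (refl , b<d) , q≡) = inj₁ (+-monoʳ-< c (*-monoʳ-< L {{>-nonZero 1≤L}} b<d))

  ladder-index : ∀ μ n {p} → p ∈ˡ ladder ℓ μ n → ladderIndex ℓ p ≡ n
  ladder-index μ n p∈ = proj₂ (∈-filter⁻ (λ p → ladderIndex ℓ p ≟ n) {xs = window μ} p∈)

  readingOrder-sorted : ∀ μ → AllPairs _[ ℓ ]≺_ (readingOrder ℓ μ)
  readingOrder-sorted μ = AllPairs.concat⁺
    (All.map⁺ (All.tabulate λ {n} _ → lex⇒≺
      (AllPairs.filter⁺ (λ p → ladderIndex ℓ p ≟ n)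
        (cartesianProduct-sorted (upTo-sorted (suc (bound μ))) (upTo-sorted (suc (row μ 0)))))
      (All.tabulate (ladder-index μ n))))
    (AllPairs.map⁺ (AllPairs.map
      (λ {n} {n′} n<n′ → All.tabulate λ p∈ → All.tabulate λ q∈ →
        inj₁ (subst₂ _<_ (sym (ladder-index μ n p∈)) (sym (ladder-index μ n′ q∈)) n<n′))
      (upTo-sorted (suc (ladderIndex ℓ (bound μ , row μ 0))))))

∈-readingOrder : ∀ ℓ μ {a b} → a ≤ bound μ → b ≤ row μ 0 → (a , b) ∈ˡ readingOrder ℓ μ
∈-readingOrder ℓ μ {a} {b} a≤ b≤ = ∈-concatMap⁺ (ladder ℓ μ) (Any.map
  (λ { refl → ∈-filter⁺ (λ p → ladderIndex ℓ p ≟ ladderIndex ℓ (a , b))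
                        (∈-cartesianProduct⁺ (∈-upTo⁺ (s≤s a≤)) (∈-upTo⁺ (s≤s b≤))) refl })
  (∈-upTo⁺ (s≤s (+-mono-≤ a≤ (*-monoʳ-≤ (ℓ ∸ 1) b≤)))))

module _ (μ : Partition) where

  pluses-letters : ∀ ps → map proj₁ (pluses (mapMaybe (letter μ) ps)) ≡ filter (addable? μ) ps
  pluses-letters []       = refl
  pluses-letters (p ∷ ps) with addable? μ p | removable? μ p
  ... | yes A | _     = trans (cong (p ∷_) (pluses-letters ps)) (sym (filter-accept (addable? μ) A))
  ... | no ¬A | yes _ = trans (pluses-letters ps) (sym (filter-reject (addable? μ) ¬A))
  ... | no ¬A | no _  = trans (pluses-letters ps) (sym (filter-reject (addable? μ) ¬A))

  minuses-letters : ∀ ps → map proj₁ (minuses (mapMaybe (letter μ) ps)) ≡ filter (removable? μ) ps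
  minuses-letters []       = refl
  minuses-letters (p ∷ ps) with addable? μ p | removable? μ p
  ... | yes A | _     =
    trans (minuses-letters ps) (sym (filter-reject (removable? μ) λ R → Addable.notIn A (Removable.isIn R)))
  ... | no _  | yes R = trans (cong (p ∷_) (minuses-letters ps)) (sym (filter-accept (removable? μ) R))
  ... | no _  | no ¬R = trans (minuses-letters ps) (sym (filter-reject (removable? μ) ¬R))

  prepend-minus : ∀ {p R} ps → All (λ q → ¬ Addable μ q) ps →
    prepend (minus p R) (mapMaybe (letter μ) ps) ≡ minus p R ∷ mapMaybe (letter μ) ps
  prepend-minus []       []         = refl
  prepend-minus (q ∷ ps) (¬A ∷ ¬As) with addable? μ q | removable? μ q
  ... | yes A | _     = contradiction A ¬A
  ... | no _  | yes _ = refl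
  ... | no _  | no _  = prepend-minus ps ¬As

  -- With no + after a -, `prepend` never finds a pair to cancel.
  reduce-letters : ∀ {ps} → AllPairs (λ p q → Removable μ p → ¬ Addable μ q) ps →
    reduce (mapMaybe (letter μ) ps) ≡ mapMaybe (letter μ) ps
  reduce-letters []                    = refl
  reduce-letters {p ∷ ps} (p¬ ∷ ps¬) with addable? μ p | removable? μ p
  ... | yes A | _     = cong (plus p A ∷_) (reduce-letters ps¬)
  ... | no _  | yes R = trans (cong (prepend (minus p R)) (reduce-letters ps¬))
                              (prepend-minus ps (All.map (λ ¬A → ¬A R) p¬))
  ... | no _  | no _  = reduce-letters ps¬

-- Corners of residue i after adding or removing one box

module _ (ℓ : ℕ) .{{_ : NonZero ℓ}} where

  residue-right-≢ : 2 ≤ ℓ → ∀ a b → residue ℓ (a , suc b) ≢ residue ℓ (a , b)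
  residue-right-≢ 2≤ℓ a b eq = let z , z≡ = diagonal ℓ a b in suc-%-≢ ℓ 2≤ℓ z
    (trans (sym (residue-shift ℓ a a (suc b) (cong suc z≡))) (trans eq (residue-shift ℓ a a b z≡)))

  residue-diagonal : ∀ a b → residue ℓ (suc a , suc b) ≡ residue ℓ (a , b)
  residue-diagonal a b = let z , z≡ = diagonal ℓ a b in
    trans (residue-shift ℓ a (suc a) (suc b) {z} (trans (+-suc z a) (cong suc z≡))) (sym (residue-shift ℓ a a b z≡))

  residue-down-≢ : 2 ≤ ℓ → ∀ a b → residue ℓ (suc a , b) ≢ residue ℓ (a , b)
  residue-down-≢ 2≤ℓ a b eq = residue-right-≢ 2≤ℓ (suc a) b (trans (residue-diagonal a b) (sym eq))

  module _ (2≤ℓ : 2 ≤ ℓ) (i : ℕ) where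

    -- Apart from `p` itself, addability depends only on the boxes above and to the left, whose
    -- residues differ from `i`.
    outerCorner-transfer : ∀ {μ ν} → (∀ q → residue ℓ q ≢ i → q ∈ μ → q ∈ ν) →
      ∀ {p} → residue ℓ p ≡ i → p ∉ ν → OuterCorner μ p → OuterCorner ν p
    outerCorner-transfer {μ} {ν} off {a , b} res p∉ outer =
      upIn⇒outerCorner ν a (≤-antisym (left b (outerCorner⇒≡ μ a outer) res) (≮⇒≥ p∉))
                           (up a res (outerCorner⇒upIn μ a outer))
      where
      up : ∀ a → residue ℓ (a , b) ≡ i → UpIn μ a b → UpIn ν a b
      up zero    _   _  = tt
      up (suc a) res b< = off (a , b) (λ e → residue-down-≢ 2≤ℓ a b (trans res (sym e))) b<
      left : ∀ b → b ≡ row μ a → residue ℓ (a , b) ≡ i → b ≤ row ν a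
      left zero    _  _   = z≤n
      left (suc b) b≡ res = off (a , b) (λ e → residue-right-≢ 2≤ℓ a b (trans res (sym e))) (≤-reflexive b≡)

    -- Removability depends only on `p` and the boxes to the right and below, again of residue other
    -- than `i`.
    innerCorner-transfer : ∀ {μ ν} → (∀ q → residue ℓ q ≢ i → q ∈ ν → q ∈ μ) →
      ∀ {p} → residue ℓ p ≡ i → p ∈ ν → InnerCorner μ p → InnerCorner ν p
    innerCorner-transfer {μ} {ν} off {a , b} res p∈ (b≡ , below) =
      ≤-antisym p∈ (≮⇒≥ λ right → <-irrefl b≡
        (off (a , suc b) (λ e → residue-right-≢ 2≤ℓ a b (trans e (sym res))) right)) ,
      ≮⇒≥ λ down → <⇒≱ (off (suc a , b) (λ e → residue-down-≢ 2≤ℓ a b (trans e (sym res))) down) below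

    module _ {κ : Partition} {p : Position} (res : residue ℓ p ≡ i) where

      private
        ≢p : ∀ {q} → residue ℓ q ≢ i → q ≢ p
        ≢p off refl = off res

      module _ (A : Addable κ p) where
        open Addable A

        private
          grow : ∀ q → q ∈ κ → q ∈ added
          grow q = from (diagram q) ∘ inj₁

          shrink : ∀ q → q ≢ p → q ∈ added → q ∈ κ
          shrink q q≢p q∈ with to (diagram q) q∈
          ... | inj₁ q∈κ = q∈κ
          ... | inj₂ q≡p = contradiction q≡p q≢p

        addable-added⁻ : ∀ {q} → AddableI ℓ i added q → AddableI ℓ i κ q × q ≢ p
        addable-added⁻ {q@(a , b)} (res-q , outer) =
          (res-q , outerCorner-transfer {added} {κ} (λ q off → shrink q (≢p off)) res-q (q∉ ∘ grow q) outer) ,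
          λ { refl → q∉ (from (diagram q) (inj₂ refl)) }
          where
          q∉ : q ∉ added
          q∉ = <-irrefl (outerCorner⇒≡ added a outer)

        addable-added⁺ : ∀ {q} → AddableI ℓ i κ q → q ≢ p → AddableI ℓ i added q
        addable-added⁺ {q@(a , b)} (res-q , outer) q≢p =
          res-q , outerCorner-transfer {κ} {added} (λ q _ → grow q) res-q
                    (<-irrefl (outerCorner⇒≡ κ a outer) ∘ shrink q q≢p) outer

        removable-added : ∀ {q} → RemovableI ℓ i added q → RemovableI ℓ i κ q ⊎ q ≡ p
        removable-added {q} (res-q , inner) with to (diagram q) (≤-reflexive (proj₁ inner))
        ... | inj₂ q≡p = inj₂ q≡p
        ... | inj₁ q∈  = inj₁ (res-q , innerCorner-transfer {added} {κ} (λ q _ → grow q) res-q q∈ inner)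

        -- Adding `p` uses up `p` and neither creates nor destroys any other addable box of residue
        -- `i`, so filling afterwards gives the same diagram.
        filled-added : ∀ {ν} → Filled ℓ i added ν → Filled ℓ i κ ν
        filled-added {ν} filled q = mk⇔ there′ back
          where
          p-addable : AddableI ℓ i κ p
          p-addable = res , addable⇒outerCorner κ p A
          there′ : q ∈ ν → q ∈ κ ⊎ AddableI ℓ i κ q
          there′ q∈ with to (filled q) q∈
          ... | inj₂ addable = inj₂ (proj₁ (addable-added⁻ addable))
          ... | inj₁ q∈+ with to (diagram q) q∈+
          ...   | inj₁ q∈κ  = inj₁ q∈κ
          ...   | inj₂ refl = inj₂ p-addable
          back : q ∈ κ ⊎ AddableI ℓ i κ q → q ∈ ν
          back (inj₁ q∈κ) = from (filled q) (inj₁ (grow q q∈κ))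
          back (inj₂ addable) with ≡-dec _≟_ _≟_ q p
          ... | yes q≡p = from (filled q) (inj₁ (from (diagram q) (inj₂ q≡p)))
          ... | no q≢p  = from (filled q) (inj₂ (addable-added⁺ addable q≢p))

      module _ (R : Removable κ p) where
        open Removable R

        private
          shrink : ∀ q → q ∈ removed → q ∈ κ
          shrink q = proj₁ ∘ to (diagram q)

          keep : ∀ q → q ≢ p → q ∈ κ → q ∈ removed
          keep q q≢p q∈ = from (diagram q) (q∈ , q≢p)

        removable-removed⁻ : ∀ {q} → RemovableI ℓ i removed q → RemovableI ℓ i κ q × q ≢ p
        removable-removed⁻ {q} (res-q , inner) =
          (res-q , innerCorner-transfer {removed} {κ} (λ q off → keep q (≢p off)) res-q (proj₁ q∈) inner) , proj₂ q∈
          where q∈ = to (diagram q) (≤-reflexive (proj₁ inner))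

        removable-removed⁺ : ∀ {q} → RemovableI ℓ i κ q → q ≢ p → RemovableI ℓ i removed q
        removable-removed⁺ {q} (res-q , inner) q≢p =
          res-q , innerCorner-transfer {κ} {removed} (λ q _ → shrink q) res-q
                    (keep q q≢p (≤-reflexive (proj₁ inner))) inner

        addable-removed : ∀ {q} → AddableI ℓ i removed q → AddableI ℓ i κ q ⊎ q ≡ p
        addable-removed {q@(a , b)} (res-q , outer) with ≡-dec _≟_ _≟_ q p
        ... | yes q≡p = inj₂ q≡p
        ... | no q≢p  = inj₁ (res-q , outerCorner-transfer {removed} {κ} (λ q _ → shrink q) res-q
                                        (<-irrefl (outerCorner⇒≡ removed a outer) ∘ keep q q≢p) outer)

        emptied-removed : ∀ {ν} → Emptied ℓ i removed ν → Emptied ℓ i κ ν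
        emptied-removed {ν} emptied q = mk⇔
          (λ q∈ → let q∈- , ¬rem = to (emptied q) q∈
                      q∈κ , q≢p = to (diagram q) q∈-
                  in q∈κ , λ rem → ¬rem (removable-removed⁺ rem q≢p))
          (λ { (q∈κ , ¬rem) → from (emptied q)
                 ( keep q (λ { refl → ¬rem (res , removable⇒innerCorner κ p R) }) q∈κ
                 , ¬rem ∘ proj₁ ∘ removable-removed⁻ ) })

-- Powers of the crystal operators

module _ {L : ℕ} (2≤L : 2 ≤ L) (i : ℕ) where

  private
    ℓ = suc L

    2≤ℓ : 2 ≤ ℓ
    2≤ℓ = m≤n⇒m≤1+n 2≤L

    residue? : ∀ p → Dec (residue ℓ p ≡ i)
    residue? p = residue ℓ p ≟ i

    candidates : Partition → List Position
    candidates κ = filter residue? (readingOrder ℓ κ)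

    candidates-sorted : ∀ κ → AllPairs _[ ℓ ]≺_ (candidates κ)
    candidates-sorted κ = AllPairs.filter⁺ residue? (readingOrder-sorted (<⇒≤ 2≤L) κ)

    addables removables : Partition → List Position
    addables   κ = filter (addable? κ) (candidates κ)
    removables κ = filter (removable? κ) (candidates κ)

    addables-sorted : ∀ κ → AllPairs _[ ℓ ]≺_ (addables κ)
    addables-sorted κ = AllPairs.filter⁺ (addable? κ) (candidates-sorted κ)

    removables-sorted : ∀ κ → AllPairs _[ ℓ ]≺_ (removables κ)
    removables-sorted κ = AllPairs.filter⁺ (removable? κ) (candidates-sorted κ)

    ∈-addables⁻ : ∀ κ {q} → q ∈ˡ addables κ → AddableI ℓ i κ q
    ∈-addables⁻ κ {q} q∈ =
      let q∈c , A = ∈-filter⁻ (addable? κ) {xs = candidates κ} q∈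
      in proj₂ (∈-filter⁻ residue? {xs = readingOrder ℓ κ} q∈c) , addable⇒outerCorner κ q A

    ∈-addables⁺ : ∀ κ {q} → AddableI ℓ i κ q → q ∈ˡ addables κ
    ∈-addables⁺ κ {a , b} (res , outer) = ∈-filter⁺ (addable? κ)
      (∈-filter⁺ residue? (∈-readingOrder ℓ κ
        (height≤bound κ {b} (outerCorner⇒upIn κ a outer , ≤-reflexive (sym b≡)))
        (≤-trans (≤-reflexive b≡) (row-anti κ z≤n))) res)
      (outerCorner⇒addable κ (a , b) outer)
      where b≡ = outerCorner⇒≡ κ a outer

    ∈-removables⁻ : ∀ κ {q} → q ∈ˡ removables κ → RemovableI ℓ i κ q
    ∈-removables⁻ κ {q} q∈ =
      let q∈c , R = ∈-filter⁻ (removable? κ) {xs = candidates κ} q∈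
      in proj₂ (∈-filter⁻ residue? {xs = readingOrder ℓ κ} q∈c) , removable⇒innerCorner κ q R

    ∈-removables⁺ : ∀ κ {q} → RemovableI ℓ i κ q → q ∈ˡ removables κ
    ∈-removables⁺ κ {a , b} (res , inner@(b≡ , _)) = ∈-filter⁺ (removable? κ)
      (∈-filter⁺ residue? (∈-readingOrder ℓ κ
        (<⇒≤ (height≤bound κ (innerCorner⇒height κ inner)))
        (≤-trans (<⇒≤ (≤-reflexive b≡)) (row-anti κ z≤n))) res)
      (innerCorner⇒removable κ (a , b) inner)

  -- The invariant of the induction: this consequence of the JM condition, rather than the condition
  -- itself, is carried through the intermediate partitions.
  Separated : Partition → Set
  Separated κ = ∀ {p q} → AddableI ℓ i κ p → RemovableI ℓ i κ q → p [ ℓ ]≺ q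

  IsJM⇒Separated : ∀ μ → IsJM ℓ μ → Separated μ
  IsJM⇒Separated μ jm (res-p , outer) (res-q , inner) =
    addable≺removable 2≤L μ jm (trans res-p (sym res-q)) outer inner

  module _ {κ : Partition} (sep : Separated κ) where

    reducedSignature≡signature : reducedSignature ℓ i κ ≡ signature ℓ i κ
    reducedSignature≡signature = reduce-letters κ (unreduced (candidates-sorted κ)
      (All.tabulate λ p∈ → proj₂ (∈-filter⁻ residue? {xs = readingOrder ℓ κ} p∈)))
      where
      unreduced : ∀ {ps} → AllPairs _[ ℓ ]≺_ ps → All (λ p → residue ℓ p ≡ i) ps →
                  AllPairs (λ p q → Removable κ p → ¬ Addable κ q) ps
      unreduced []         []           = []
      unreduced (p≺ ∷ ps≺) (res ∷ ress) = All.zipWith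
        (λ { {q} (p≺q , res-q) R A → ≺-asym ℓ p≺q
               (sep (res-q , addable⇒outerCorner κ q A) (res , removable⇒innerCorner κ _ R)) })
        (p≺ , ress) ∷ unreduced ps≺ ress

    pluses-positions : map proj₁ (pluses (reducedSignature ℓ i κ)) ≡ addables κ
    pluses-positions = trans (cong (map proj₁ ∘ pluses) reducedSignature≡signature) (pluses-letters κ (candidates κ))

    minuses-positions : map proj₁ (minuses (reducedSignature ℓ i κ)) ≡ removables κ
    minuses-positions = trans (cong (map proj₁ ∘ minuses) reducedSignature≡signature) (minuses-letters κ (candidates κ))

  φ̂≡ : ∀ {κ} → Separated κ → φ̂ ℓ i κ ≡ length (addables κ)
  φ̂≡ {κ} sep =
    trans (sym (length-map proj₁ (pluses (reducedSignature ℓ i κ)))) (cong length (pluses-positions {κ} sep))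

  ε̂≡ : ∀ {κ} → Separated κ → ε̂ ℓ i κ ≡ length (removables κ)
  ε̂≡ {κ} sep =
    trans (sym (length-map proj₁ (minuses (reducedSignature ℓ i κ)))) (cong length (minuses-positions {κ} sep))

  -- Nothing cancels, so the rightmost + is the last addable box of residue `i`, and adding it
  -- leaves exactly the earlier ones.
  f̂-step : ∀ {κ n} → Separated κ → φ̂ ℓ i κ ≡ suc n →
    ∃[ p ] ∃[ A ] f̂ ℓ i κ ≡ just (Addable.added {κ} {p} A) × residue ℓ p ≡ i
      × Separated (Addable.added A) × φ̂ ℓ i (Addable.added A) ≡ n
  f̂-step {κ} {n} sep φ≡ with pluses (reducedSignature ℓ i κ) | pluses-positions {κ} sep
  ... | P | positions with initLast P
  ...   | P′ ∷ʳ′ (p , A) = p , A , cong (Maybe.map (Addable.added ∘ proj₂)) (last-∷ʳ P′ (p , A)) , res , sep⁺ , φ⁺≡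
    where
    κ⁺ = Addable.added A

    earlier = map proj₁ P′

    split : addables κ ≡ earlier ∷ʳ p
    split = trans (sym positions) (map-++ proj₁ P′ ((p , A) ∷ []))

    sorted : AllPairs _[ ℓ ]≺_ earlier × All (λ q → q [ ℓ ]≺ p) earlier
    sorted = AllPairs-∷ʳ⁻ earlier (subst (AllPairs _[ ℓ ]≺_) split (addables-sorted κ))

    res : residue ℓ p ≡ i
    res = proj₁ (∈-addables⁻ κ (subst (p ∈ˡ_) (sym split) (∈-++⁺ʳ earlier (here refl))))

    ∈-earlier⁺ : ∀ {q} → AddableI ℓ i κ⁺ q → q ∈ˡ earlier
    ∈-earlier⁺ {q} addable with addable-added⁻ ℓ 2≤ℓ i res A addable
    ... | addable′ , q≢p with ∈-++⁻ earlier (subst (q ∈ˡ_) split (∈-addables⁺ κ addable′))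
    ...   | inj₁ q∈         = q∈
    ...   | inj₂ (here q≡p) = contradiction q≡p q≢p

    ∈-earlier⁻ : ∀ {q} → q ∈ˡ earlier → AddableI ℓ i κ⁺ q
    ∈-earlier⁻ {q} q∈ = addable-added⁺ ℓ 2≤ℓ i res A
      (∈-addables⁻ κ (subst (q ∈ˡ_) (sym split) (∈-++⁺ˡ q∈)))
      λ { refl → let p≺p = All.lookup (proj₂ sorted) q∈ in ≺-asym ℓ p≺p p≺p }

    sep⁺ : Separated κ⁺
    sep⁺ addable removable with removable-added ℓ 2≤ℓ i res A removable
    ... | inj₁ removable′ = sep (proj₁ (addable-added⁻ ℓ 2≤ℓ i res A addable)) removable′
    -- The box just added is the only new removable one; it was the last addable box, so the
    -- remaining ones all precede it.
    ... | inj₂ refl       = All.lookup (proj₂ sorted) (∈-earlier⁺ addable)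

    addables⁺ : addables κ⁺ ≡ earlier
    addables⁺ = sorted-unique (≺-asym ℓ) (addables-sorted κ⁺) (proj₁ sorted)
      (∈-earlier⁺ ∘ ∈-addables⁻ κ⁺) (∈-addables⁺ κ⁺ ∘ ∈-earlier⁻)

    φ⁺≡ : φ̂ ℓ i κ⁺ ≡ n
    φ⁺≡ = trans (φ̂≡ {κ⁺} sep⁺) (trans (cong length addables⁺) (trans (length-map proj₁ P′)
            (suc-injective (trans (+-comm 1 (length P′)) (trans (sym (length-++ P′)) φ≡)))))

  -- Each step lowers `φ̂` by one; at 0 no addable box of residue `i` is left, and the partition is
  -- its own filling.
  f̂-fills : ∀ n {κ} → Separated κ → φ̂ ℓ i κ ≡ n → ∃[ ν ] f̂ ℓ i ^⟨ n ⟩ κ ≡ just ν × Filled ℓ i κ ν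
  f̂-fills zero {κ} sep φ≡ = κ , refl , λ q → mk⇔ inj₁ λ
    { (inj₁ q∈)      → q∈
    ; (inj₂ addable) → contradiction (∈-length (∈-addables⁺ κ addable))
                                     (n≮0 ∘ subst (0 <_) (trans (sym (φ̂≡ {κ} sep)) φ≡))
    }
  f̂-fills (suc n) {κ} sep φ≡ =
    let p , A , f≡ , res , sep⁺ , φ⁺≡ = f̂-step {κ} sep φ≡
        ν , fⁿ≡ , filled = f̂-fills n {Addable.added A} sep⁺ φ⁺≡
    in ν , trans (cong (_>>= (f̂ ℓ i ^⟨ n ⟩_)) f≡) fⁿ≡ , filled-added ℓ 2≤ℓ i res A {ν} filled

  -- The leftmost - is the first removable box of residue `i`. Once removed it becomes addable and
  -- precedes all remaining removable ones, so the invariant persists.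
  ê-step : ∀ {κ n} → Separated κ → ε̂ ℓ i κ ≡ suc n →
    ∃[ p ] ∃[ R ] ê ℓ i κ ≡ just (Removable.removed {κ} {p} R) × residue ℓ p ≡ i
      × Separated (Removable.removed R) × ε̂ ℓ i (Removable.removed R) ≡ n
  ê-step {κ} {n} sep ε≡ with minuses (reducedSignature ℓ i κ) | minuses-positions {κ} sep
  ... | (p , R) ∷ P′ | positions = p , R , refl , res , sep⁻ , ε⁻≡
    where
    κ⁻ = Removable.removed R

    later = map proj₁ P′

    sorted : AllPairs _[ ℓ ]≺_ (p ∷ later)
    sorted = subst (AllPairs _[ ℓ ]≺_) (sym positions) (removables-sorted κ)

    p≺ : All (p [ ℓ ]≺_) later
    p≺ = AllPairs.head sorted

    res : residue ℓ p ≡ i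
    res = proj₁ (∈-removables⁻ κ (subst (p ∈ˡ_) positions (here refl)))

    ∈-later⁺ : ∀ {q} → RemovableI ℓ i κ⁻ q → q ∈ˡ later
    ∈-later⁺ {q} removable with removable-removed⁻ ℓ 2≤ℓ i res R removable
    ... | removable′ , q≢p with subst (q ∈ˡ_) (sym positions) (∈-removables⁺ κ removable′)
    ...   | here q≡p = contradiction q≡p q≢p
    ...   | there q∈ = q∈

    ∈-later⁻ : ∀ {q} → q ∈ˡ later → RemovableI ℓ i κ⁻ q
    ∈-later⁻ {q} q∈ = removable-removed⁺ ℓ 2≤ℓ i res R
      (∈-removables⁻ κ (subst (q ∈ˡ_) positions (there q∈)))
      λ { refl → let p≺p = All.lookup p≺ q∈ in ≺-asym ℓ p≺p p≺p }

    sep⁻ : Separated κ⁻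
    sep⁻ addable removable with addable-removed ℓ 2≤ℓ i res R addable
    ... | inj₁ addable′ = sep addable′ (proj₁ (removable-removed⁻ ℓ 2≤ℓ i res R removable))
    ... | inj₂ refl     = All.lookup p≺ (∈-later⁺ removable)

    removables⁻ : removables κ⁻ ≡ later
    removables⁻ = sorted-unique (≺-asym ℓ) (removables-sorted κ⁻) (AllPairs.tail sorted)
      (∈-later⁺ ∘ ∈-removables⁻ κ⁻) (∈-removables⁺ κ⁻ ∘ ∈-later⁻)

    ε⁻≡ : ε̂ ℓ i κ⁻ ≡ n
    ε⁻≡ = trans (ε̂≡ {κ⁻} sep⁻) (trans (cong length removables⁻) (trans (length-map proj₁ P′) (suc-injective ε≡)))

  ê-empties : ∀ n {κ} → Separated κ → ε̂ ℓ i κ ≡ n → ∃[ ν ] ê ℓ i ^⟨ n ⟩ κ ≡ just ν × Emptied ℓ i κ ν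
  ê-empties zero {κ} sep ε≡ = κ , refl , λ q → mk⇔
    (λ q∈ → q∈ , λ removable → contradiction (∈-length (∈-removables⁺ κ removable))
                                           (n≮0 ∘ subst (0 <_) (trans (sym (ε̂≡ {κ} sep)) ε≡)))
    proj₁
  ê-empties (suc n) {κ} sep ε≡ =
    let p , R , e≡ , res , sep⁻ , ε⁻≡ = ê-step {κ} sep ε≡
        ν , eⁿ≡ , emptied = ê-empties n {Removable.removed R} sep⁻ ε⁻≡
    in ν , trans (cong (_>>= (ê ℓ i ^⟨ n ⟩_)) e≡) eⁿ≡ , emptied-removed ℓ 2≤ℓ i res R {ν} emptied

theorem3p7p3p1 : (ℓ : ℕ) .{{_ : NonZero ℓ}} → 3 ≤ ℓ →
    (μ : Partition) → IsJM ℓ μ →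
    (i : ℕ) → i < ℓ →
    (∃[ ν ] f̂ ℓ i ^⟨ φ̂ ℓ i μ ⟩ μ ≡ just ν × IsJM ℓ ν)
    × (∃[ ν ] ê ℓ i ^⟨ ε̂ ℓ i μ ⟩ μ ≡ just ν × IsJM ℓ ν)
theorem3p7p3p1 ℓ@(suc L) (s≤s 2≤L) μ jm i i<ℓ =
  let sep = IsJM⇒Separated 2≤L i μ jm
      ν⁺ , f≡ , filled  = f̂-fills 2≤L i (φ̂ ℓ i μ) {μ} sep refl
      ν⁻ , e≡ , emptied = ê-empties 2≤L i (ε̂ ℓ i μ) {μ} sep refl
      2≤ℓ = m≤n⇒m≤1+n 2≤L
  in (ν⁺ , f≡ , filled-IsJM ℓ i 2≤ℓ i<ℓ {μ} {ν⁺} jm filled) , (ν⁻ , e≡ , emptied-IsJM ℓ i 2≤ℓ i<ℓ {μ} {ν⁻} jm emptied)
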